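{- Let $0<\alpha<1/4$ be a constant and let $d=d(n)$ satisfy $n^{1/2+\alpha}<d<n^{1-\alpha}$. Let $G_{n,d}$ be a uniformly random $d$-regular graph on $n$ labeled vertices. Then asymptotically almost surely (i.e. with probability tending to $1$ as $n\to\infty$), $$m(G_{n,d}) \le \chi(G_{n,d}).$$
   Context: $\chi$ denotes chromatic number. A graph homomorphism $\phi:G\to H$ is a map $V(G)\to V(H)$ sending edges to edges; $\mathrm{Hom}(H,G)$ denotes the set of homomorphisms $H\to G$, made into a graph by joining two homomorphisms by an edge when they differ at exactly one vertex. A graph $G$ is $d$-mobile if the graph $\mathrm{Hom}(H,G)$ is connected for every finite simple graph $H$ of maximum degree $d-2$; the mobility $m(G)$ is the largest $d$ for which $G$ is $d$-mobile. -}

module Defs where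

open import Data.Nat using (ℕ; zero; suc; _+_; _*_; _∸_; _^_; _≤_; _<_)
open import Data.Fin using (Fin)
open import Data.Bool using (Bool; true; false; if_then_else_)
open import Data.List using (List; map; allFin; length)
open import Data.Nat.ListAction using (sum)
open import Data.List.Relation.Unary.All using (All)
open import Data.List.Relation.Unary.AllPairs using (AllPairs)
open import Data.Product using (Σ; ∃; _×_; _,_)
open import Relation.Nullary using (¬_)
open import Relation.Binary.PropositionalEquality using (_≡_; _≢_)
open import Relation.Binary.Construct.Closure.ReflexiveTransitive using (Star)

Adj : ℕ → Set
Adj n = Fin n → Fin n → Bool

SimpleGraph : ∀ {n} → Adj n → Set
SimpleGraph {n} G = (∀ i j → G i j ≡ G j i) × (∀ i → G i i ≡ false)

degree : ∀ {n} → Adj n → Fin n → ℕ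
degree {n} G i = sum (map (λ j → if G i j then 1 else 0) (allFin n))

Regular : ∀ {n} → ℕ → Adj n → Set
Regular {n} d G = SimpleGraph G × (∀ i → degree G i ≡ d)

Differ : ∀ {n} → Adj n → Adj n → Set
Differ {n} G G' = Σ (Fin n) λ i → Σ (Fin n) λ j → G i j ≢ G' i j

Hom : ∀ {m n} → Adj m → Adj n → Set
Hom {m} {n} H G = Σ (Fin m → Fin n) λ φ → ∀ u v → H u v ≡ true → G (φ u) (φ v) ≡ true

HomAdj : ∀ {m n} {H : Adj m} {G : Adj n} → Hom H G → Hom H G → Set
HomAdj {m} (φ , _) (ψ , _) = Σ (Fin m) λ v → (φ v ≢ ψ v) × (∀ u → u ≢ v → φ u ≡ ψ u)

HomConnected : ∀ {m n} → Adj m → Adj n → Set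
HomConnected H G = ∀ (φ ψ : Hom H G) → Star (HomAdj {H = H} {G = G}) φ ψ

-- G is k-mobile: Hom(H,G) connected for every finite simple graph H of
-- maximum degree at most k - 2 (i.e. every degree d satisfies d + 2 ≤ k)
Mobile : ∀ {n} → ℕ → Adj n → Set
Mobile k G = ∀ (m : ℕ) (H : Adj m) → SimpleGraph H → (∀ v → degree H v + 2 ≤ k) → HomConnected H G

Colorable : ∀ {n} → ℕ → Adj n → Set
Colorable {n} c G = Σ (Fin n → Fin c) λ f → ∀ i j → G i j ≡ true → f i ≢ f j

IsChromaticNumber : ∀ {n} → Adj n → ℕ → Set
IsChromaticNumber G c = Colorable c G × (∀ c' → c' < c → ¬ Colorable c' G)

-- m(G) ≤ χ(G): every k for which G is k-mobile is at most χ(G)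
MobilityLeChromatic : ∀ {n} → Adj n → Set
MobilityLeChromatic G = ∀ c → IsChromaticNumber G c → ∀ k → Mobile k G → k ≤ c

-- With M = 16q, almost every d-regular graph G has all codegrees at most (1 + 1/M) d²/n:
-- replacing edges uw, ab (w a common neighbour of u, v) by ua, wb lowers the codegree of
-- u, v by one, and counting these switchings in both directions shows that the number of
-- graphs with codegree j decays geometrically in j above d²/n. Such a G is not
-- 8q-colourable: for an independent set S, Cauchy–Schwarz applied to the number of
-- neighbours in S of the vertices outside S bounds |S| by the codegrees in S.
-- On the other hand, since codegrees are at most 2d·(d/n) and d < n^(1-p/q), v should be
-- the only common neighbour of 4q neighbours of v. To use every vertex equally often,
-- work on the arcs of G: rotating an arc around its tail and then reversing it permutes
-- the arcs and moves the tail to a neighbour. For r = 4q suitable rotations, chosen by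
-- averaging, the graph H on two copies of the arcs generated by these r permutations has
-- degree at most 8q < χ(G), and its tail map to G is an isolated vertex of Hom(H,G).
-- As H is bipartite it also maps onto an edge of G, so Hom(H,G) is disconnected.
module Submission where

open import Defs
open import Data.Nat using (ℕ; zero; suc; _+_; _*_; _∸_; _^_; _≤_; _<_; z≤n; s≤s; _≡ᵇ_; _<ᵇ_; NonZero; >-nonZero; _/_; _%_; _≤?_)
open import Data.Nat.Properties hiding (_≟_; _≤?_)
open import Data.Nat.DivMod using (_mod_; m/n*n≤m; m≡m%n+[m/n]*n; m%n<n; m*n/n≡m; /-monoˡ-≤; %-distribˡ-+; [m+n]%n≡m%n; m<n⇒m%n≡m; m%n%n≡m%n)
open import Data.Nat.ListAction using (sum)
open import Data.Nat.Tactic.RingSolver using (solve-∀)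
open import Data.Bool using (Bool; true; false; if_then_else_; _∧_; _∨_; _xor_; not; T?)
open import Data.Bool.Properties using (∧-comm; ∨-comm; ∧-zeroʳ; xor-comm; xor-identityʳ; not-involutive; T-≡)
import Data.Bool.Properties as Bool
open import Data.Fin using (Fin; zero; suc; toℕ; fromℕ<; _≟_; inject≤; combine; remQuot)
open import Data.Fin.Properties using (toℕ<n; toℕ-injective; toℕ-fromℕ<; all?; inject≤-injective; remQuot-combine; combine-remQuot)
open import Data.List using (List; []; _∷_; map; allFin; tabulate; length; filterᵇ; lookup; upTo; cartesianProductWith)
open import Data.List.Properties using (map-tabulate; tabulate-lookup; length-tabulate; length-upTo)
open import Data.List.Membership.Propositional using (_∈_)
open import Data.List.Membership.Propositional.Properties using (∈-allFin; ∈-upTo⁺)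
open import Data.List.Relation.Unary.Any using (Any; here; there; _─_)
open import Data.List.Relation.Unary.Any.Properties using (cartesianProductWith⁺)
open import Data.List.Relation.Unary.All as All using (All; []; _∷_)
import Data.List.Relation.Unary.All.Properties as All
open import Data.List.Relation.Unary.AllPairs as AllPairs using (AllPairs; []; _∷_)
import Data.List.Relation.Unary.AllPairs.Properties as AllPairs
open import Data.Product using (Σ; ∃; _×_; _,_; proj₁; proj₂)
open import Data.Sum using (_⊎_; inj₁; inj₂)
import Data.Sum as Sum
open import Data.Vec using (Vec; []; _∷_)
import Data.Vec as Vec
open import Function using (_∘_; id; Equivalence)
open import Relation.Nullary using (¬_; Dec; yes; no; does; contradiction; _×-dec_)
open import Relation.Nullary.Decidable using (dec-true)
open import Relation.Binary.PropositionalEquality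
open import Relation.Binary.Construct.Closure.ReflexiveTransitive using (Star; ε; _◅_)

-- Finite sums

-- A constant lower bound on the chromatic number is enough: a number above a chromatic number that
-- exceeds 8q is at least 8q + 2, so H may have degree 8q. M = 16q is twice 8q because a colour
-- class of density at least 1/(8q) sends all its edges to its complement, and this gain has to beat
-- the relative codegree error 1/M. The number r = 4q comes from (d/n)^q < n^(-p): a vertex other
-- than v remains a common neighbour for a proportion at most 2d/n of the choices of each further
-- rotation, and (2d/n)^(4q) outweighs the at most n²d pairs of a vertex and an arc once n ≥ 2^(4q).
-- The lower bound on d makes d²/n exceed a power of n, so geometric decay over about d²/(2Mn) steps
-- beats a union bound of size about n³. All ratios are cleared of denominators, and graphs are
-- compared pointwise.

⟦_⟧ : Bool → ℕ
⟦ b ⟧ = if b then 1 else 0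

∑ : {A : Set} → List A → (A → ℕ) → ℕ
∑ xs f = sum (map f xs)

∑ᶠ : ∀ {n} → (Fin n → ℕ) → ℕ
∑ᶠ {n} = ∑ (allFin n)

module _ {A : Set} where

  ∑-cong : ∀ (xs : List A) {f g : A → ℕ} → (∀ x → f x ≡ g x) → ∑ xs f ≡ ∑ xs g
  ∑-cong []       f≡g = refl
  ∑-cong (x ∷ xs) f≡g = cong₂ _+_ (f≡g x) (∑-cong xs f≡g)

  ∑-mono : ∀ (xs : List A) {f g : A → ℕ} → (∀ x → f x ≤ g x) → ∑ xs f ≤ ∑ xs g
  ∑-mono []       f≤g = z≤n
  ∑-mono (x ∷ xs) f≤g = +-mono-≤ (f≤g x) (∑-mono xs f≤g)

  ∑-distrib-+ : ∀ (xs : List A) (f g : A → ℕ) → ∑ xs (λ x → f x + g x) ≡ ∑ xs f + ∑ xs g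
  ∑-distrib-+ []       f g = refl
  ∑-distrib-+ (x ∷ xs) f g =
    trans (cong (f x + g x +_) (∑-distrib-+ xs f g)) (interchange (f x) (g x) (∑ xs f) (∑ xs g))
    where
    interchange : ∀ a b c d → a + b + (c + d) ≡ a + c + (b + d)
    interchange = solve-∀

  *-distribˡ-∑ : ∀ (xs : List A) k (f : A → ℕ) → k * ∑ xs f ≡ ∑ xs (λ x → k * f x)
  *-distribˡ-∑ []       k f = *-zeroʳ k
  *-distribˡ-∑ (x ∷ xs) k f =
    trans (*-distribˡ-+ k (f x) (∑ xs f)) (cong (k * f x +_) (*-distribˡ-∑ xs k f))

  *-distribʳ-∑ : ∀ (xs : List A) k (f : A → ℕ) → ∑ xs f * k ≡ ∑ xs (λ x → f x * k)
  *-distribʳ-∑ xs k f = trans (*-comm (∑ xs f) k)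
    (trans (*-distribˡ-∑ xs k f) (∑-cong xs λ x → *-comm k (f x)))

  ∑-const : ∀ (xs : List A) k → ∑ xs (λ _ → k) ≡ length xs * k
  ∑-const []       k = refl
  ∑-const (x ∷ xs) k = cong (k +_) (∑-const xs k)

  ≤-∑ : ∀ {xs : List A} (f : A → ℕ) {x} → x ∈ xs → f x ≤ ∑ xs f
  ≤-∑ {_ ∷ xs} f (here refl) = m≤m+n _ (∑ xs f)
  ≤-∑ {y ∷ _}  f (there x∈)  = ≤-trans (≤-∑ f x∈) (m≤n+m _ (f y))

  ∑-filterᵇ : ∀ (p : A → Bool) xs (f : A → ℕ) → ∑ (filterᵇ p xs) f ≡ ∑ xs (λ x → ⟦ p x ⟧ * f x)
  ∑-filterᵇ p []       f = refl
  ∑-filterᵇ p (x ∷ xs) f with p x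
  ... | true  = cong₂ _+_ (sym (+-identityʳ (f x))) (∑-filterᵇ p xs f)
  ... | false = ∑-filterᵇ p xs f

  length-filterᵇ : ∀ (p : A → Bool) xs → length (filterᵇ p xs) ≡ ∑ xs (λ x → ⟦ p x ⟧)
  length-filterᵇ p []       = refl
  length-filterᵇ p (x ∷ xs) with p x
  ... | true  = cong suc (length-filterᵇ p xs)
  ... | false = length-filterᵇ p xs

∑-comm : ∀ {A B : Set} (xs : List A) (ys : List B) (f : A → B → ℕ) →
         ∑ xs (λ x → ∑ ys (f x)) ≡ ∑ ys (λ y → ∑ xs (λ x → f x y))
∑-comm []       ys f = sym (trans (∑-const ys 0) (*-zeroʳ (length ys)))
∑-comm (x ∷ xs) ys f = trans (cong (∑ ys (f x) +_) (∑-comm xs ys f))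
  (sym (∑-distrib-+ ys (f x) (λ y → ∑ xs (λ z → f z y))))

∑ᶠ-suc : ∀ {n} (f : Fin (suc n) → ℕ) → ∑ᶠ f ≡ f zero + ∑ᶠ (f ∘ suc)
∑ᶠ-suc f = cong (λ l → f zero + sum l)
  (trans (map-tabulate suc f) (sym (map-tabulate id (f ∘ suc))))

∑ᶠ-const : ∀ {n} k → ∑ᶠ {n} (λ _ → k) ≡ n * k
∑ᶠ-const {n} k = trans (∑-const (allFin n) k) (cong (_* k) (length-tabulate {n = n} id))

≤-∑ᶠ : ∀ {n} (f : Fin n → ℕ) i → f i ≤ ∑ᶠ f
≤-∑ᶠ f i = ≤-∑ f (∈-allFin i)

∑ᶠ≡0⇒≡0 : ∀ {n} (f : Fin n → ℕ) → ∑ᶠ f ≡ 0 → ∀ i → f i ≡ 0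
∑ᶠ≡0⇒≡0 f eq i = n≤0⇒n≡0 (subst (f i ≤_) eq (≤-∑ᶠ f i))

∑-≤-const : ∀ {n} (f : Fin n → ℕ) k → (∀ i → f i ≤ k) → ∑ᶠ f ≤ n * k
∑-≤-const {n} f k f≤k = ≤-trans (∑-mono (allFin n) f≤k) (≤-reflexive (∑ᶠ-const {n} k))

∃-below-average : ∀ n (f : Fin (suc n) → ℕ) → ∃ λ t → suc n * f t ≤ ∑ᶠ f
∃-below-average zero    f = zero , ≤-refl
∃-below-average (suc n) f with ∃-below-average n (f ∘ suc)
... | t , t≤ with f zero ≤? f (suc t)
... | yes f₀≤ = zero , subst (suc (suc n) * f zero ≤_) (sym (∑ᶠ-suc f))
                  (+-monoʳ-≤ (f zero) (≤-trans (*-monoʳ-≤ (suc n) f₀≤) t≤))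
... | no  f₀≰ = suc t , subst (suc (suc n) * f (suc t) ≤_) (sym (∑ᶠ-suc f))
                  (+-mono-≤ (≰⇒≥ f₀≰) t≤)

∃-above-average : ∀ n (f : Fin (suc n) → ℕ) → ∃ λ t → ∑ᶠ f ≤ suc n * f t
∃-above-average zero    f = zero , ≤-refl
∃-above-average (suc n) f with ∃-above-average n (f ∘ suc)
... | t , ≤t with f zero ≤? f (suc t)
... | yes f₀≤ = suc t , subst (_≤ suc (suc n) * f (suc t)) (sym (∑ᶠ-suc f)) (+-mono-≤ f₀≤ ≤t)
... | no  f₀≰ = zero , subst (_≤ suc (suc n) * f zero) (sym (∑ᶠ-suc f))
                  (+-monoʳ-≤ (f zero) (≤-trans ≤t (*-monoʳ-≤ (suc n) (≰⇒≥ f₀≰))))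

_==_ : ∀ {n} → Fin n → Fin n → Bool
i == j = does (i ≟ j)

==-refl : ∀ {n} (i : Fin n) → (i == i) ≡ true
==-refl i with i ≟ i
... | yes _   = refl
... | no  i≢i = contradiction refl i≢i

≢⇒==-false : ∀ {n} {i j : Fin n} → i ≢ j → (i == j) ≡ false
≢⇒==-false {i = i} {j} i≢j with i ≟ j
... | yes i≡j = contradiction i≡j i≢j
... | no  _   = refl

==-true⇒≡ : ∀ {n} {i j : Fin n} → (i == j) ≡ true → i ≡ j
==-true⇒≡ {i = i} {j} eq with i ≟ j
... | yes i≡j = i≡j

==-false⇒≢ : ∀ {n} {i j : Fin n} → (i == j) ≡ false → i ≢ j
==-false⇒≢ {i = i} {j} eq with i ≟ j
... | no i≢j = i≢j

==-suc : ∀ {n} (i j : Fin n) → (suc i == suc j) ≡ (i == j)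
==-suc i j with i ≟ j
... | yes _ = refl
... | no  _ = refl

==-sym : ∀ {n} (i j : Fin n) → (i == j) ≡ (j == i)
==-sym i j with i ≟ j
... | yes refl = sym (==-refl i)
... | no  i≢j  = sym (≢⇒==-false (i≢j ∘ sym))

∑ᶠ-δ* : ∀ {n} (i : Fin n) (f : Fin n → ℕ) → ∑ᶠ (λ j → ⟦ j == i ⟧ * f j) ≡ f i
∑ᶠ-δ* {suc n} zero    f = trans (∑ᶠ-suc {n} (λ j → ⟦ j == zero ⟧ * f j))
  (trans (cong (f zero + 0 +_) (trans (∑ᶠ-const {n} 0) (*-zeroʳ n)))
         (trans (+-identityʳ _) (+-identityʳ _)))
∑ᶠ-δ* {suc n} (suc i) f = trans (∑ᶠ-suc {n} (λ j → ⟦ j == suc i ⟧ * f j))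
  (trans (∑-cong (allFin n) λ j → cong (λ b → ⟦ b ⟧ * f (suc j)) (==-suc j i)) (∑ᶠ-δ* i (f ∘ suc)))

∑ᶠ-δ : ∀ {n} (i : Fin n) → ∑ᶠ (λ j → ⟦ j == i ⟧) ≡ 1
∑ᶠ-δ {n} i = trans (∑-cong (allFin n) λ j → sym (*-identityʳ ⟦ j == i ⟧)) (∑ᶠ-δ* i (λ _ → 1))

⟦⟧≤1 : ∀ b → ⟦ b ⟧ ≤ 1
⟦⟧≤1 true  = ≤-refl
⟦⟧≤1 false = z≤n

∧-true : ∀ {a b} → a ∧ b ≡ true → a ≡ true × b ≡ true
∧-true {true} {true} _ = refl , refl

⟦⟧-∧ : ∀ a b → ⟦ a ∧ b ⟧ ≡ ⟦ a ⟧ * ⟦ b ⟧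
⟦⟧-∧ true  b = sym (+-identityʳ _)
⟦⟧-∧ false b = refl

-- Counting graphs

Any-─ : ∀ {A : Set} {P Q : A → Set} {xs} → (∀ {x} → P x → ¬ Q x) →
        (p : Any P xs) → Any Q xs → Any Q (xs ─ p)
Any-─ disjoint (here p)  (here q)  = contradiction q (disjoint p)
Any-─ disjoint (here p)  (there q) = q
Any-─ disjoint (there p) (here q)  = here q
Any-─ disjoint (there p) (there q) = there (Any-─ disjoint p q)

length-─ : ∀ {A : Set} {P : A → Set} {xs} (p : Any P xs) → length xs ≡ suc (length (xs ─ p))
length-─ (here p)  = refl
length-─ (there p) = cong suc (length-─ p)

-- A pigeonhole argument: each entry of `xs` takes a partner in `ys`, which is then deleted; by
-- apartness no later entry needs the deleted one. A relation replaces a function because the image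
-- of a graph occurs in a list only up to pointwise equality.
length-≤-by-injection : ∀ {A B : Set} {_#_ : A → A → Set} {R : A → B → Set} →
  (∀ {x x′ y} → R x y → R x′ y → ¬ x # x′) →
  ∀ {xs ys} → AllPairs _#_ xs → All (λ x → Any (R x) ys) xs → length xs ≤ length ys
length-≤-by-injection inj []         []       = z≤n
length-≤-by-injection inj (x# ∷ xs#) (p ∷ ps) =
  subst (_ ≤_) (sym (length-─ p))
    (s≤s (length-≤-by-injection inj xs# (All.zipWith (λ (x#x′ , q) → Any-─ (λ r r′ → inj r r′ x#x′) p q) (x# , ps))))

Any-filterᵇ : ∀ {A : Set} {P : A → Set} (q : A → Bool) {xs} →
              (∀ {x} → P x → q x ≡ true) → Any P xs → Any P (filterᵇ q xs)
Any-filterᵇ q {x ∷ _} P⇒q (here p)  with q x | P⇒q p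
... | true | _ = here p
Any-filterᵇ q {x ∷ _} P⇒q (there p) with q x
... | true  = there (Any-filterᵇ q P⇒q p)
... | false = Any-filterᵇ q P⇒q p

module _ {A : Set} where

  consᶠ : ∀ {n} → A → (Fin n → A) → Fin (suc n) → A
  consᶠ x f zero    = x
  consᶠ x f (suc i) = f i

  functions : ∀ n → List A → List (Fin n → A)
  functions zero    xs = (λ ()) ∷ []
  functions (suc n) xs = cartesianProductWith consᶠ xs (functions n xs)

  module _ {_≈_ : A → A → Set} {xs : List A} (complete : ∀ x → Any (_≈ x) xs) where

    functions-complete : ∀ n (f : Fin n → A) → Any (λ g → ∀ i → g i ≈ f i) (functions n xs)
    functions-complete zero    f = here λ ()
    functions-complete (suc n) f =
      cartesianProductWith⁺ consᶠ
        (λ x≈ g≈ → λ { zero → x≈ ; (suc i) → g≈ i })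
        (complete (f zero)) (functions-complete n (f ∘ suc))

  module _ {_#_ : A → A → Set} where

    functions-apart : ∀ n {xs} → AllPairs _#_ xs →
                      AllPairs (λ f g → ∃ λ i → f i # g i) (functions n xs)
    functions-apart zero    xs# = [] ∷ []
    functions-apart (suc n) {xs} xs# = go xs#
      where
      fs = functions n xs

      all-apart : ∀ {x} {ys : List A} → All (x #_) ys → ∀ gs (f : Fin n → A) →
        All (λ h → ∃ λ i → consᶠ x f i # h i) (cartesianProductWith consᶠ ys gs)
      all-apart []        gs f = []
      all-apart (x# ∷ xs#) gs f =
        All.++⁺ (All.map⁺ (All.universal (λ _ → zero , x#) gs)) (all-apart xs# gs f)

      go : ∀ {ys} → AllPairs _#_ ys →
           AllPairs (λ f g → ∃ λ i → f i # g i) (cartesianProductWith consᶠ ys fs)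
      go []         = []
      go (x# ∷ ys#) = AllPairs.++⁺
        (AllPairs.map⁺ (AllPairs.map (λ (i , a) → suc i , a) (functions-apart n xs#)))
        (go ys#)
        (All.map⁺ (All.universal (all-apart x# fs) fs))

_≐_ : ∀ {n} → Adj n → Adj n → Set
G ≐ G′ = ∀ i j → G i j ≡ G′ i j

-- All graphs, each represented once up to pointwise equality.
graphs : ∀ n → List (Adj n)
graphs n = functions n (functions n (true ∷ false ∷ []))

graphs-complete : ∀ {n} (G : Adj n) → Any (_≐ G) (graphs n)
graphs-complete {n} = functions-complete (functions-complete bools n) n
  where
  bools : ∀ b → Any (_≡ b) (true ∷ false ∷ [])
  bools true  = here refl
  bools false = there (here refl)

graphs-apart : ∀ n → AllPairs Differ (graphs n)
graphs-apart n = functions-apart n {_} (functions-apart {_#_ = _≢_} n {true ∷ false ∷ []} (((λ ()) ∷ []) ∷ [] ∷ []))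

≐⇒¬Differ : ∀ {n} {G G′ : Adj n} → G ≐ G′ → ¬ Differ G G′
≐⇒¬Differ G≐G′ (i , j , G≢G′) = G≢G′ (G≐G′ i j)

-- The image of a graph is found in `graphs` only up to `_≐_`, so the predicate counted on the
-- target side must transfer along it.
RespectsTrue : ∀ {n} → (Adj n → Bool) → Set
RespectsTrue Q = ∀ {G G′} → G ≐ G′ → Q G ≡ true → Q G′ ≡ true

all-filterᵇ : ∀ {A : Set} (p : A → Bool) xs → All (λ x → p x ≡ true) (filterᵇ p xs)
all-filterᵇ p xs = All.map (Equivalence.to T-≡) (All.all-filter (T? ∘ p) xs)

count-≤-by-injection : ∀ {n} (P Q : Adj n → Bool) (θ : Adj n → Adj n) → RespectsTrue Q →
  (∀ {G G′} → θ G ≐ θ G′ → G ≐ G′) → (∀ G → P G ≡ true → Q (θ G) ≡ true) →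
  ∑ (graphs n) (λ G → ⟦ P G ⟧) ≤ ∑ (graphs n) (λ G → ⟦ Q G ⟧)
count-≤-by-injection {n} P Q θ Q-resp θ-inj P⇒Q =
  subst₂ _≤_ (length-filterᵇ P (graphs n)) (length-filterᵇ Q (graphs n))
    (length-≤-by-injection {R = λ G G′ → G′ ≐ θ G}
      (λ r r′ → ≐⇒¬Differ (θ-inj λ i j → trans (sym (r i j)) (r′ i j)))
      (AllPairs.filter⁺ (T? ∘ P) (graphs-apart n))
      (All.map (λ {G} PG → Any-filterᵇ Q (λ r → Q-resp (λ i j → sym (r i j)) (P⇒Q G PG)) (graphs-complete (θ G)))
               (all-filterᵇ P (graphs n))))

regular? : ∀ {n} d (G : Adj n) → Dec (Regular d G)
regular? d G =
  (all? (λ i → all? λ j → G i j Bool.≟ G j i) ×-dec all? (λ i → G i i Bool.≟ false))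
  ×-dec all? (λ i → degree G i Data.Nat.≟ d)

isRegular : ∀ {n} → ℕ → Adj n → Bool
isRegular d G = does (regular? d G)

isRegular-sound : ∀ {n d} {G : Adj n} → isRegular d G ≡ true → Regular d G
isRegular-sound {d = d} {G} = does-sound (regular? d G)
  where
  does-sound : ∀ {P : Set} (P? : Dec P) → does P? ≡ true → P
  does-sound (yes p) _ = p

isRegular-complete : ∀ {n d} {G : Adj n} → Regular d G → isRegular d G ≡ true
isRegular-complete {d = d} {G} = dec-true (regular? d G)

Regular-resp : ∀ {n d} {G G′ : Adj n} → G ≐ G′ → Regular d G → Regular d G′
Regular-resp {n} e ((s , l) , r) =
  ((λ i j → trans (sym (e i j)) (trans (s i j) (e j i))) , (λ i → trans (sym (e i i)) (l i))) ,
  λ i → trans (∑-cong (allFin n) λ j → cong ⟦_⟧ (sym (e i j))) (r i)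

-- The link between counting in `graphs` and the theorem, where the list to compare with is
-- arbitrary.
every-≤-regular : ∀ {n d} (Every : List (Adj n)) → AllPairs Differ Every → All (Regular d) Every →
  length Every ≤ ∑ (graphs n) (λ G → ⟦ isRegular d G ⟧)
every-≤-regular {n} {d} Every apart regular =
  subst (_ ≤_) (length-filterᵇ (isRegular d) (graphs n))
    (length-≤-by-injection {R = λ G G′ → G′ ≐ G}
      (λ r r′ → ≐⇒¬Differ λ i j → trans (sym (r i j)) (r′ i j))
      apart
      (All.map (λ {G} reg → Any-filterᵇ (isRegular d)
                 (λ r → isRegular-complete (Regular-resp (λ i j → sym (r i j)) reg)) (graphs-complete G))
               regular))

-- Switchings

codegree : ∀ {n} → Adj n → Fin n → Fin n → ℕ
codegree G u v = ∑ᶠ λ j → ⟦ G u j ⟧ * ⟦ G v j ⟧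

isArc : ∀ {n} → Fin n → Fin n → Fin n → Fin n → Bool
isArc x y i j = ((i == x) ∧ (j == y)) ∨ ((i == y) ∧ (j == x))

-- The exclusive or makes adding and removing an edge the same map, injective without conditions;
-- which of the two happens matters only for the degrees.
flip : ∀ {n} → Fin n → Fin n → Adj n → Adj n
flip x y G i j = G i j xor isArc x y i j

isArc-off : ∀ {n} {x y i j : Fin n} → i ≢ x ⊎ j ≢ y → i ≢ y ⊎ j ≢ x → isArc x y i j ≡ false
isArc-off {x = x} {y} {i} {j} p q = cong₂ _∨_ (off p) (off q)
  where
  off : ∀ {n} {i x j y : Fin n} → i ≢ x ⊎ j ≢ y → (i == x) ∧ (j == y) ≡ false
  off (inj₁ i≢x) rewrite ≢⇒==-false i≢x = refl
  off {i = i} {x} (inj₂ j≢y) rewrite ≢⇒==-false j≢y = ∧-zeroʳ (i == x)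

flip-off : ∀ {n} {x y : Fin n} (G : Adj n) {i j} → i ≢ x ⊎ j ≢ y → i ≢ y ⊎ j ≢ x →
           flip x y G i j ≡ G i j
flip-off G {i} {j} p q = trans (cong (G i j xor_) (isArc-off p q)) (xor-identityʳ (G i j))

flip-on : ∀ {n} (x y : Fin n) (G : Adj n) → flip x y G x y ≡ not (G x y)
flip-on x y G rewrite ==-refl x | ==-refl y = xor-comm (G x y) true

flip-injective : ∀ {n} (x y : Fin n) {G G′ : Adj n} → flip x y G ≐ flip x y G′ → G ≐ G′
flip-injective x y {G} {G′} e i j = xor-cancelʳ (G i j) (G′ i j) (isArc x y i j) (e i j)
  where
  xor-cancelʳ : ∀ a b c → a xor c ≡ b xor c → a ≡ b
  xor-cancelʳ true  true  c     e = refl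
  xor-cancelʳ false false c     e = refl
  xor-cancelʳ true  false false ()
  xor-cancelʳ true  false true  ()
  xor-cancelʳ false true  false ()
  xor-cancelʳ false true  true  ()

flip-simple : ∀ {n} {x y : Fin n} {G : Adj n} → x ≢ y → SimpleGraph G → SimpleGraph (flip x y G)
flip-simple {x = x} {y} {G} x≢y (s , l) =
  (λ i j → cong₂ _xor_ (s i j) (isArc-sym i j)) ,
  (λ i → trans (flip-off G (split i) (Sum.swap (split i))) (l i))
  where
  isArc-sym : ∀ i j → isArc x y i j ≡ isArc x y j i
  isArc-sym i j = trans (∨-comm ((i == x) ∧ (j == y)) _)
    (cong₂ _∨_ (∧-comm (i == y) (j == x)) (∧-comm (i == x) (j == y)))
  split : ∀ i → i ≢ x ⊎ i ≢ y
  split i with i ≟ x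
  ... | yes refl = inj₂ x≢y
  ... | no  i≢x  = inj₁ i≢x

module _ {n} {x y : Fin n} (x≢y : x ≢ y) (G : Adj n) where

  private
    arc-sum : Fin n → Fin n → ℕ
    arc-sum i j = ⟦ i == x ⟧ * ⟦ j == y ⟧ + ⟦ i == y ⟧ * ⟦ j == x ⟧

    ∑-arc-sum : ∀ i → ∑ᶠ (arc-sum i) ≡ ⟦ i == x ⟧ + ⟦ i == y ⟧
    ∑-arc-sum i = trans (∑-distrib-+ (allFin n) (λ j → ⟦ i == x ⟧ * ⟦ j == y ⟧) _)
      (cong₂ _+_ (row (i == x) y) (row (i == y) x))
      where
      row : ∀ b z → ∑ᶠ {n} (λ j → ⟦ b ⟧ * ⟦ j == z ⟧) ≡ ⟦ b ⟧
      row b z = trans (sym (*-distribˡ-∑ (allFin n) ⟦ b ⟧ _))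
        (trans (cong (⟦ b ⟧ *_) (∑ᶠ-δ z)) (*-identityʳ _))

  degree-flip-add : G x y ≡ false → G y x ≡ false → ∀ i →
                    degree (flip x y G) i ≡ degree G i + (⟦ i == x ⟧ + ⟦ i == y ⟧)
  degree-flip-add Gxy Gyx i =
    trans (∑-cong (allFin n) pointwise)
      (trans (∑-distrib-+ (allFin n) (λ j → ⟦ G i j ⟧) (arc-sum i)) (cong (degree G i +_) (∑-arc-sum i)))
    where
    pointwise : ∀ j → ⟦ flip x y G i j ⟧ ≡ ⟦ G i j ⟧ + arc-sum i j
    pointwise j with i ≟ x | j ≟ y | i ≟ y | j ≟ x
    ... | yes refl | yes refl | yes x≡y  | _        = contradiction x≡y x≢y
    ... | yes refl | yes refl | no _     | _        rewrite Gxy = refl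
    ... | yes refl | no _     | yes x≡y  | _        = contradiction x≡y x≢y
    ... | yes refl | no _     | no _     | _        rewrite xor-identityʳ (G x j) = sym (+-identityʳ _)
    ... | no _     | _        | yes refl | yes refl rewrite Gyx = refl
    ... | no _     | _        | yes refl | no _     rewrite xor-identityʳ (G y j) = sym (+-identityʳ _)
    ... | no _     | _        | no _     | _        rewrite xor-identityʳ (G i j) = sym (+-identityʳ _)

  degree-flip-remove : G x y ≡ true → G y x ≡ true → ∀ i →
                       degree (flip x y G) i + (⟦ i == x ⟧ + ⟦ i == y ⟧) ≡ degree G i
  degree-flip-remove Gxy Gyx i =
    trans (trans (cong (degree (flip x y G) i +_) (sym (∑-arc-sum i)))
                 (sym (∑-distrib-+ (allFin n) (λ j → ⟦ flip x y G i j ⟧) (arc-sum i))))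
          (∑-cong (allFin n) pointwise)
    where
    pointwise : ∀ j → ⟦ flip x y G i j ⟧ + arc-sum i j ≡ ⟦ G i j ⟧
    pointwise j with i ≟ x | j ≟ y | i ≟ y | j ≟ x
    ... | yes refl | yes refl | yes x≡y  | _        = contradiction x≡y x≢y
    ... | yes refl | yes refl | no _     | _        rewrite Gxy = refl
    ... | yes refl | no _     | yes x≡y  | _        = contradiction x≡y x≢y
    ... | yes refl | no _     | no _     | _        rewrite xor-identityʳ (G x j) = +-identityʳ _
    ... | no _     | _        | yes refl | yes refl rewrite Gyx = refl
    ... | no _     | _        | yes refl | no _     rewrite xor-identityʳ (G y j) = +-identityʳ _
    ... | no _     | _        | no _     | _        rewrite xor-identityʳ (G i j) = +-identityʳ _

module RegularGraph {n d} {G : Adj n} (regular : Regular d G) where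
  simple = proj₁ regular
  sym-G  = proj₁ simple
  irr-G  = proj₂ simple
  deg-G  = proj₂ regular

-- Two removals followed by two additions. For fixed vertices the map is injective without any
-- hypothesis on `G`, so each choice of `w`, `a`, `b` can be counted by itself.
switch : ∀ {n} → Fin n → Fin n → Fin n → Fin n → Adj n → Adj n
switch u w a b G = flip w b (flip u a (flip a b (flip u w G)))

switch-injective : ∀ {n} (u w a b : Fin n) {G G′ : Adj n} →
                   switch u w a b G ≐ switch u w a b G′ → G ≐ G′
switch-injective u w a b e =
  flip-injective u w (flip-injective a b (flip-injective u a (flip-injective w b e)))

inClosed : ∀ {n} → Adj n → Fin n → Fin n → Bool
inClosed G x y = G x y ∨ (y == x)

¬inClosed⇒ : ∀ {n} (G : Adj n) {x y} → not (inClosed G x y) ≡ true → G x y ≡ false × y ≢ x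
¬inClosed⇒ G {x} {y} eq with G x y
... | false = refl , ==-false⇒≢ (not-true eq)
  where
  not-true : ∀ {b} → not b ≡ true → b ≡ false
  not-true {false} _ = refl

-- These conditions make `ua` and `wb` new edges and keep `a` from becoming a common neighbour of
-- `u` and `v`. The other inequalities needed, `w ≢ a`, `b ≢ u` and `b ≢ v`, follow by comparing
-- adjacencies.
admissible : ∀ {n} → Adj n → Fin n → Fin n → Fin n → Fin n → Fin n → Bool
admissible G u v w a b =
  G a b ∧ (not (inClosed G u a) ∧ (not (inClosed G v a) ∧ not (inClosed G w b)))

forward : ∀ {n} → Adj n → Fin n → Fin n → Fin n → Fin n → Fin n → Bool
forward G u v w a b = (G u w ∧ G v w) ∧ admissible G u v w a b

-- Only part of what the switched graph satisfies. So weak a condition overcounts the inverse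
-- switchings, which is harmless for an upper bound, and makes the count exactly `d * (d * d)`.
backward : ∀ {n} → Adj n → Fin n → Fin n → Fin n → Fin n → Fin n → Bool
backward G u v w a b = G v w ∧ (G u a ∧ G w b)

module _ {n d} {G : Adj n} (regular : Regular d G) {u v : Fin n} (u≢v : u ≢ v)
         {w a b : Fin n} (fwd : forward G u v w a b ≡ true) where

  open RegularGraph regular

  private
    G₁ = flip u w G
    G₂ = flip a b G₁
    G₃ = flip u a G₂
    G₄ = flip w b G₃

    Guw = proj₁ (∧-true {G u w} (proj₁ (∧-true {G u w ∧ G v w} fwd)))
    Gvw = proj₂ (∧-true {G u w} (proj₁ (∧-true {G u w ∧ G v w} fwd)))
    adm = proj₂ (∧-true {G u w ∧ G v w} fwd)
    Gab = proj₁ (∧-true {G a b} adm)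
    outside = ∧-true {not (inClosed G u a)} (proj₂ (∧-true {G a b} adm))
    outside′ = ∧-true {not (inClosed G v a)} (proj₂ outside)
    Gua = proj₁ (¬inClosed⇒ G (proj₁ outside))
    a≢u = proj₂ (¬inClosed⇒ G (proj₁ outside))
    Gva = proj₁ (¬inClosed⇒ G (proj₁ outside′))
    a≢v = proj₂ (¬inClosed⇒ G (proj₁ outside′))
    Gwb = proj₁ (¬inClosed⇒ G (proj₂ outside′))
    b≢w = proj₂ (¬inClosed⇒ G (proj₂ outside′))

    separates : ∀ {x y} (f : Fin n → Bool) → f x ≡ true → f y ≡ false → x ≢ y
    separates f fx fy refl with trans (sym fx) fy
    ... | ()

    u≢w : u ≢ w
    u≢w = separates (λ x → G x w) Guw (irr-G w)
    v≢w : v ≢ w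
    v≢w = separates (λ x → G x w) Gvw (irr-G w)
    a≢b : a ≢ b
    a≢b = separates (λ x → G x b) Gab (irr-G b)
    w≢a : w ≢ a
    w≢a = separates (G u) Guw Gua
    b≢u : b ≢ u
    b≢u = separates (G a) Gab (trans (sym-G a u) Gua)
    b≢v : b ≢ v
    b≢v = separates (G a) Gab (trans (sym-G a v) Gva)

    simple₁ = flip-simple {G = G} u≢w simple
    simple₂ = flip-simple {G = G₁} a≢b simple₁
    simple₃ = flip-simple {G = G₂} (≢-sym a≢u) simple₂
    simple₄ = flip-simple {G = G₃} (≢-sym b≢w) simple₃

    G₁ab : G₁ a b ≡ true
    G₁ab = trans (flip-off G (inj₁ a≢u) (inj₂ b≢u)) Gab

    G₂ua : G₂ u a ≡ false
    G₂ua = trans (flip-off G₁ (inj₁ (≢-sym a≢u)) (inj₁ (≢-sym b≢u)))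
          (trans (flip-off G (inj₂ (≢-sym w≢a)) (inj₁ u≢w)) Gua)

    G₃wb : G₃ w b ≡ false
    G₃wb = trans (flip-off G₂ (inj₁ (≢-sym u≢w)) (inj₁ w≢a))
          (trans (flip-off G₁ (inj₁ w≢a) (inj₁ (≢-sym b≢w)))
          (trans (flip-off G (inj₁ (≢-sym u≢w)) (inj₂ b≢u)) Gwb))

    row-u : ∀ {j} → j ≢ w → j ≢ a → G₄ u j ≡ G u j
    row-u j≢w j≢a = trans (flip-off G₃ (inj₁ u≢w) (inj₁ (≢-sym b≢u)))
      (trans (flip-off G₂ (inj₂ j≢a) (inj₁ (≢-sym a≢u)))
      (trans (flip-off G₁ (inj₁ (≢-sym a≢u)) (inj₁ (≢-sym b≢u)))
             (flip-off G (inj₂ j≢w) (inj₁ u≢w))))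

    row-v : ∀ j → G₄ v j ≡ G v j
    row-v j = trans (flip-off G₃ (inj₁ v≢w) (inj₁ (≢-sym b≢v)))
      (trans (flip-off G₂ (inj₁ (≢-sym u≢v)) (inj₁ (≢-sym a≢v)))
      (trans (flip-off G₁ (inj₁ (≢-sym a≢v)) (inj₁ (≢-sym b≢v)))
             (flip-off G (inj₁ (≢-sym u≢v)) (inj₁ v≢w))))

    G₄uw : G₄ u w ≡ false
    G₄uw = trans (flip-off G₃ (inj₁ u≢w) (inj₁ (≢-sym b≢u)))
      (trans (flip-off G₂ (inj₂ w≢a) (inj₁ (≢-sym a≢u)))
      (trans (flip-off G₁ (inj₁ (≢-sym a≢u)) (inj₁ (≢-sym b≢u)))
      (trans (flip-on u w G) (cong not Guw))))

    G₄ua : G₄ u a ≡ true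
    G₄ua = trans (flip-off G₃ (inj₁ u≢w) (inj₁ (≢-sym b≢u)))
                 (trans (flip-on u a G₂) (cong not G₂ua))

  switch-regular : Regular d (switch u w a b G)
  switch-regular = simple₄ , λ i → trans (degrees i) (deg-G i)
    where
    degrees : ∀ i → degree G₄ i ≡ degree G i
    degrees i = begin
      degree G₄ i
        ≡⟨ degree-flip-add (≢-sym b≢w) G₃ G₃wb (trans (proj₁ simple₃ b w) G₃wb) i ⟩
      degree G₃ i + (iw + ib)
        ≡⟨ cong (_+ (iw + ib)) (degree-flip-add (≢-sym a≢u) G₂ G₂ua (trans (proj₁ simple₂ a u) G₂ua) i) ⟩
      degree G₂ i + (iu + ia) + (iw + ib)
        -- Each of the four vertices lies on one added and one removed edge, so the same four
        -- indicators serve for both.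
        ≡⟨ comm (degree G₂ i) iu ia iw ib ⟩
      degree G₂ i + (ia + ib) + (iu + iw)
        ≡⟨ cong (_+ (iu + iw)) (degree-flip-remove a≢b G₁ G₁ab (trans (proj₁ simple₁ b a) G₁ab) i) ⟩
      degree G₁ i + (iu + iw)
        ≡⟨ degree-flip-remove u≢w G Guw (trans (sym-G w u) Guw) i ⟩
      degree G i ∎
      where
      open ≡-Reasoning
      iu = ⟦ i == u ⟧
      ia = ⟦ i == a ⟧
      iw = ⟦ i == w ⟧
      ib = ⟦ i == b ⟧
      comm : ∀ g u a w b → g + (u + a) + (w + b) ≡ g + (a + b) + (u + w)
      comm = solve-∀

  -- Row `v` is untouched and row `u` changes only at `w` and `a`: the common neighbour `w` is lost,
  -- and `a` is not adjacent to `v`.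
  switch-codegree : codegree G u v ≡ suc (codegree (switch u w a b G) u v)
  switch-codegree = begin
    codegree G u v
      ≡⟨ ∑-cong (allFin n) pointwise ⟩
    ∑ᶠ (λ j → ⟦ j == w ⟧ + ⟦ G₄ u j ⟧ * ⟦ G₄ v j ⟧)
      ≡⟨ ∑-distrib-+ (allFin n) (λ j → ⟦ j == w ⟧) _ ⟩
    ∑ᶠ (λ j → ⟦ j == w ⟧) + codegree G₄ u v
      ≡⟨ cong (_+ codegree G₄ u v) (∑ᶠ-δ w) ⟩
    suc (codegree G₄ u v) ∎
    where
    open ≡-Reasoning
    pointwise : ∀ j → ⟦ G u j ⟧ * ⟦ G v j ⟧ ≡ ⟦ j == w ⟧ + ⟦ G₄ u j ⟧ * ⟦ G₄ v j ⟧
    pointwise j = by-cases (j ≟ w) (j ≟ a)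
      where
      by-cases : Dec (j ≡ w) → Dec (j ≡ a) → ⟦ G u j ⟧ * ⟦ G v j ⟧ ≡ ⟦ j == w ⟧ + ⟦ G₄ u j ⟧ * ⟦ G₄ v j ⟧
      by-cases (yes refl) _ = trans (cong₂ (λ p q → ⟦ p ⟧ * ⟦ q ⟧) Guw Gvw)
        (sym (cong₂ (λ e p → ⟦ e ⟧ + ⟦ p ⟧ * ⟦ G₄ v w ⟧) (==-refl w) G₄uw))
      by-cases (no a≢w) (yes refl) = trans (cong (λ p → ⟦ p ⟧ * ⟦ G v a ⟧) Gua)
        (sym (trans (cong₂ (λ e q → ⟦ e ⟧ + ⟦ G₄ u a ⟧ * ⟦ q ⟧) (≢⇒==-false a≢w) (trans (row-v a) Gva))
                    (*-zeroʳ ⟦ G₄ u a ⟧)))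
      by-cases (no j≢w) (no j≢a) = sym (trans
        (cong (λ e → ⟦ e ⟧ + ⟦ G₄ u j ⟧ * ⟦ G₄ v j ⟧) (≢⇒==-false j≢w))
        (cong₂ (λ p q → ⟦ p ⟧ * ⟦ q ⟧) (row-u j≢w j≢a) (row-v j)))

  switch-backward : backward (switch u w a b G) u v w a b ≡ true
  switch-backward = cong₂ _∧_ (trans (row-v w) Gvw)
    (cong₂ _∧_ G₄ua (trans (flip-on w b G₃) (cong not G₃wb)))

-- Counting switchings in both directions

∑³ : ∀ {n} → (Fin n → Fin n → Fin n → ℕ) → ℕ
∑³ f = ∑ᶠ λ w → ∑ᶠ λ a → ∑ᶠ λ b → f w a b

∑³-mono : ∀ {n} {f g : Fin n → Fin n → Fin n → ℕ} → (∀ w a b → f w a b ≤ g w a b) → ∑³ f ≤ ∑³ g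
∑³-mono {n} f≤g =
  ∑-mono (allFin n) λ w → ∑-mono (allFin n) λ a → ∑-mono (allFin n) λ b → f≤g w a b

*-distribˡ-∑³ : ∀ {n} k (f : Fin n → Fin n → Fin n → ℕ) → k * ∑³ f ≡ ∑³ (λ w a b → k * f w a b)
*-distribˡ-∑³ {n} k f = trans (*-distribˡ-∑ (allFin n) k _) (∑-cong (allFin n) λ w →
  trans (*-distribˡ-∑ (allFin n) k _) (∑-cong (allFin n) λ a → *-distribˡ-∑ (allFin n) k _))

∑-∑³-comm : ∀ {A : Set} {n} (xs : List A) (f : A → Fin n → Fin n → Fin n → ℕ) →
            ∑ xs (λ x → ∑³ (f x)) ≡ ∑³ (λ w a b → ∑ xs (λ x → f x w a b))
∑-∑³-comm {n = n} xs f = trans (∑-comm xs (allFin n) _) (∑-cong (allFin n) λ w →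
  trans (∑-comm xs (allFin n) _) (∑-cong (allFin n) λ a → ∑-comm xs (allFin n) _))

module _ {n d} {G : Adj n} (regular : Regular d G) where

  open RegularGraph regular

  ∑-closed : ∀ x → ∑ᶠ (λ y → ⟦ inClosed G x y ⟧) ≤ suc d
  ∑-closed x = begin
    ∑ᶠ (λ y → ⟦ inClosed G x y ⟧)             ≤⟨ ∑-mono (allFin n) (λ y → ⟦∨⟧≤ (G x y) (y == x)) ⟩
    ∑ᶠ (λ y → ⟦ y == x ⟧ + ⟦ G x y ⟧)         ≡⟨ ∑-distrib-+ (allFin n) (λ y → ⟦ y == x ⟧) _ ⟩
    ∑ᶠ (λ y → ⟦ y == x ⟧) + degree G x        ≡⟨ cong₂ _+_ (∑ᶠ-δ x) (deg-G x) ⟩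
    suc d                                     ∎
    where
    open ≤-Reasoning
    ⟦∨⟧≤ : ∀ p q → ⟦ p ∨ q ⟧ ≤ ⟦ q ⟧ + ⟦ p ⟧
    ⟦∨⟧≤ true  q = m≤n+m 1 ⟦ q ⟧
    ⟦∨⟧≤ false q = m≤m+n ⟦ q ⟧ 0

  ∑-arcs-from : ∀ (f : Fin n → ℕ) → ∑ᶠ (λ a → ∑ᶠ λ b → f a * ⟦ G a b ⟧) ≡ ∑ᶠ f * d
  ∑-arcs-from f = trans
    (∑-cong (allFin n) λ a → trans (sym (*-distribˡ-∑ (allFin n) (f a) _)) (cong (f a *_) (deg-G a)))
    (sym (*-distribʳ-∑ (allFin n) d f))

  ∑-arcs-to : ∀ (f : Fin n → ℕ) → ∑ᶠ (λ a → ∑ᶠ λ b → f b * ⟦ G a b ⟧) ≡ ∑ᶠ f * d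
  ∑-arcs-to f = trans (∑-comm (allFin n) (allFin n) _)
    (trans (∑-cong (allFin n) λ b → ∑-cong (allFin n) λ a → cong (λ e → f b * ⟦ e ⟧) (sym-G a b))
           (∑-arcs-from f))

  -- The arcs lost are those that start in the closed neighbourhood of `u` or of `v` or end in that
  -- of `w`. Each of these has at most `suc d` vertices, hence accounts for at most `suc d * d`
  -- arcs.
  admissible-count : ∀ u v w →
    n * d ≤ ∑ᶠ (λ a → ∑ᶠ λ b → ⟦ admissible G u v w a b ⟧) + 3 * (suc d * d)
  admissible-count u v w = begin
    n * d
      ≡⟨ cong (_* d) (sym (trans (∑ᶠ-const {n} 1) (*-identityʳ n))) ⟩
    ∑ᶠ {n} (λ _ → 1) * d
      ≡⟨ sym (∑-arcs-from (λ _ → 1)) ⟩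
    ∑ᶠ (λ a → ∑ᶠ λ b → 1 * ⟦ G a b ⟧)
      ≤⟨ ∑-mono (allFin n) (λ a → ∑-mono (allFin n) λ b →
           union-bound (G a b) (inClosed G u a) (inClosed G v a) (inClosed G w b)) ⟩
    ∑ᶠ (λ a → ∑ᶠ λ b → ok a b + (U a * ⟦ G a b ⟧ + (V a * ⟦ G a b ⟧ + W b * ⟦ G a b ⟧)))
      ≡⟨ ∑∑-distrib ok _ ⟩
    ∑∑ ok + ∑∑ (λ a b → U a * ⟦ G a b ⟧ + (V a * ⟦ G a b ⟧ + W b * ⟦ G a b ⟧))
      ≡⟨ cong (∑∑ ok +_) (trans (∑∑-distrib (λ a b → U a * ⟦ G a b ⟧) _)
           (cong (∑∑ (λ a b → U a * ⟦ G a b ⟧) +_) (∑∑-distrib (λ a b → V a * ⟦ G a b ⟧) _))) ⟩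
    ∑∑ ok + (∑∑ (λ a b → U a * ⟦ G a b ⟧) + (∑∑ (λ a b → V a * ⟦ G a b ⟧) + ∑∑ (λ a b → W b * ⟦ G a b ⟧)))
      ≡⟨ cong (∑∑ ok +_) (cong₂ _+_ (∑-arcs-from U) (cong₂ _+_ (∑-arcs-from V) (∑-arcs-to W))) ⟩
    ∑∑ ok + (∑ᶠ U * d + (∑ᶠ V * d + ∑ᶠ W * d))
      ≤⟨ +-monoʳ-≤ (∑∑ ok) (+-mono-≤ (*-monoˡ-≤ d (∑-closed u))
           (+-mono-≤ (*-monoˡ-≤ d (∑-closed v)) (*-monoˡ-≤ d (∑-closed w)))) ⟩
    ∑∑ ok + (suc d * d + (suc d * d + suc d * d))
      ≡⟨ cong (λ z → ∑∑ ok + (suc d * d + (suc d * d + z))) (sym (+-identityʳ _)) ⟩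
    ∑∑ ok + 3 * (suc d * d) ∎
    where
    open ≤-Reasoning
    ∑∑ : (Fin n → Fin n → ℕ) → ℕ
    ∑∑ f = ∑ᶠ λ a → ∑ᶠ λ b → f a b
    ok = λ a b → ⟦ admissible G u v w a b ⟧
    U V W : Fin n → ℕ
    U a = ⟦ inClosed G u a ⟧
    V a = ⟦ inClosed G v a ⟧
    W b = ⟦ inClosed G w b ⟧
    ∑∑-distrib : ∀ f g → ∑∑ (λ a b → f a b + g a b) ≡ ∑∑ f + ∑∑ g
    ∑∑-distrib f g = trans (∑-cong (allFin n) λ a → ∑-distrib-+ (allFin n) (f a) (g a))
                           (∑-distrib-+ (allFin n) _ _)
    union-bound : ∀ g p q r → 1 * ⟦ g ⟧ ≤
      ⟦ g ∧ (not p ∧ (not q ∧ not r)) ⟧ + (⟦ p ⟧ * ⟦ g ⟧ + (⟦ q ⟧ * ⟦ g ⟧ + ⟦ r ⟧ * ⟦ g ⟧))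
    union-bound false p q r = z≤n
    union-bound true true  q r = s≤s z≤n
    union-bound true false true  r = s≤s z≤n
    union-bound true false false true  = s≤s z≤n
    union-bound true false false false = s≤s z≤n

  forward-count : ∀ u v →
    codegree G u v * (n * d) ≤ ∑³ (λ w a b → ⟦ forward G u v w a b ⟧) + codegree G u v * (3 * (suc d * d))
  forward-count u v = begin
    codegree G u v * (n * d)
      ≡⟨ *-distribʳ-∑ (allFin n) (n * d) common ⟩
    ∑ᶠ (λ w → common w * (n * d))
      ≤⟨ ∑-mono (allFin n) (λ w → *-monoʳ-≤ (common w) (admissible-count u v w)) ⟩
    ∑ᶠ (λ w → common w * (A w + B))
      ≡⟨ ∑-cong (allFin n) (λ w → *-distribˡ-+ (common w) (A w) B) ⟩
    ∑ᶠ (λ w → common w * A w + common w * B)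
      ≡⟨ ∑-distrib-+ (allFin n) (λ w → common w * A w) _ ⟩
    ∑ᶠ (λ w → common w * A w) + ∑ᶠ (λ w → common w * B)
      ≡⟨ cong₂ _+_ (∑-cong (allFin n) expand) (sym (*-distribʳ-∑ (allFin n) B common)) ⟩
    ∑³ (λ w a b → ⟦ forward G u v w a b ⟧) + codegree G u v * B ∎
    where
    open ≤-Reasoning
    B = 3 * (suc d * d)
    common : Fin n → ℕ
    common w = ⟦ G u w ⟧ * ⟦ G v w ⟧
    A : Fin n → ℕ
    A w = ∑ᶠ λ a → ∑ᶠ λ b → ⟦ admissible G u v w a b ⟧
    expand : ∀ w → common w * A w ≡ ∑ᶠ λ a → ∑ᶠ λ b → ⟦ forward G u v w a b ⟧
    expand w = trans (*-distribˡ-∑ (allFin n) (common w) _) (∑-cong (allFin n) λ a →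
      trans (*-distribˡ-∑ (allFin n) (common w) _) (∑-cong (allFin n) λ b →
      sym (trans (⟦⟧-∧ (G u w ∧ G v w) _)
                 (cong (_* ⟦ admissible G u v w a b ⟧) (⟦⟧-∧ (G u w) (G v w))))))

  backward-count : ∀ u v → ∑³ (λ w a b → ⟦ backward G u v w a b ⟧) ≡ d * (d * d)
  backward-count u v = begin
    ∑³ (λ w a b → ⟦ backward G u v w a b ⟧)
      ≡⟨ ∑-cong (allFin n) (λ w → trans (∑-cong (allFin n) λ a → trans
           (∑-cong (allFin n) λ b → trans (⟦⟧-∧ (G v w) _)
              (trans (cong (⟦ G v w ⟧ *_) (⟦⟧-∧ (G u a) (G w b))) (sym (*-assoc ⟦ G v w ⟧ _ _))))
           (row (⟦ G v w ⟧ * ⟦ G u a ⟧) w))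
           (trans (sym (*-distribʳ-∑ (allFin n) d _)) (cong (_* d) (row ⟦ G v w ⟧ u)))) ⟩
    ∑ᶠ (λ w → ⟦ G v w ⟧ * d * d)
      ≡⟨ trans (sym (*-distribʳ-∑ (allFin n) d _)) (cong (_* d) (sym (*-distribʳ-∑ (allFin n) d _))) ⟩
    degree G v * d * d
      ≡⟨ trans (cong (λ z → z * d * d) (deg-G v)) (*-assoc d d d) ⟩
    d * (d * d) ∎
    where
    open ≡-Reasoning
    row : ∀ k x → ∑ᶠ (λ b → k * ⟦ G x b ⟧) ≡ k * d
    row k x = trans (sym (*-distribˡ-∑ (allFin n) k _)) (cong (k *_) (deg-G x))

hasCodegree : ∀ {n} → ℕ → Fin n → Fin n → ℕ → Adj n → Bool
hasCodegree d u v j G = isRegular d G ∧ (codegree G u v ≡ᵇ j)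

#codegree : ∀ n → ℕ → Fin n → Fin n → ℕ → ℕ
#codegree n d u v j = ∑ (graphs n) λ G → ⟦ hasCodegree d u v j G ⟧

≡ᵇ-sound : ∀ {m n} → (m ≡ᵇ n) ≡ true → m ≡ n
≡ᵇ-sound {m} {n} eq = ≡ᵇ⇒≡ m n (Equivalence.from T-≡ eq)

≡ᵇ-complete : ∀ {m n} → m ≡ n → (m ≡ᵇ n) ≡ true
≡ᵇ-complete {m} {n} eq = Equivalence.to T-≡ (≡⇒≡ᵇ m n eq)

codegree-resp : ∀ {n} {G G′ : Adj n} → G ≐ G′ → ∀ u v → codegree G u v ≡ codegree G′ u v
codegree-resp {n} e u v = ∑-cong (allFin n) λ j → cong₂ (λ p q → ⟦ p ⟧ * ⟦ q ⟧) (e u j) (e v j)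

module _ {n d : ℕ} {u v : Fin n} (u≢v : u ≢ v) (j : ℕ) where

  private
    N N′ : Adj n → Bool
    N  = hasCodegree d u v (suc j)
    N′ = hasCodegree d u v j

    switching : ∀ w a b →
      ∑ (graphs n) (λ G → ⟦ N G ∧ forward G u v w a b ⟧) ≤ ∑ (graphs n) (λ G → ⟦ N′ G ∧ backward G u v w a b ⟧)
    switching w a b = count-≤-by-injection
      (λ G → N G ∧ forward G u v w a b) (λ G → N′ G ∧ backward G u v w a b)
      (switch u w a b) Q-resp (switch-injective u w a b) maps
      where
      Q-resp : RespectsTrue (λ G → N′ G ∧ backward G u v w a b)
      Q-resp {G} {G′} e q with ∧-true {N′ G} q
      ... | q₁ , q₂ with ∧-true {isRegular d G} q₁
      ... | reg , cod = cong₂ _∧_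
        (cong₂ _∧_ (isRegular-complete (Regular-resp e (isRegular-sound reg)))
                   (trans (cong (_≡ᵇ j) (sym (codegree-resp e u v))) cod))
        (trans (sym (cong₂ _∧_ (e v w) (cong₂ _∧_ (e u a) (e w b)))) q₂)
      maps : ∀ G → N G ∧ forward G u v w a b ≡ true →
             N′ (switch u w a b G) ∧ backward (switch u w a b G) u v w a b ≡ true
      maps G p with ∧-true {N G} p
      ... | p₁ , fwd with ∧-true {isRegular d G} p₁
      ... | reg , cod with isRegular-sound {G = G} reg
      ... | r = cong₂ _∧_
        (cong₂ _∧_ (isRegular-complete (switch-regular r u≢v fwd))
                   (≡ᵇ-complete (suc-injective (trans (sym (switch-codegree r u≢v fwd)) (≡ᵇ-sound cod)))))
        (switch-backward r u≢v fwd)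

  -- For fixed `w`, `a`, `b` the switch injects forward configurations into backward ones. Summed
  -- over all triples, a graph of codegree `suc j` has `suc j * (n * d)` forward ones up to the
  -- inadmissible arcs, a loss that is moved to the right instead of subtracted.
  codegree-switching : #codegree n d u v (suc j) * (suc j * (n * d)) ≤
    #codegree n d u v j * (d * (d * d)) + #codegree n d u v (suc j) * (suc j * (3 * (suc d * d)))
  codegree-switching = begin
    #codegree n d u v (suc j) * (suc j * (n * d))
      ≡⟨ *-distribʳ-∑ (graphs n) _ _ ⟩
    ∑ (graphs n) (λ G → ⟦ N G ⟧ * (suc j * (n * d)))
      ≤⟨ ∑-mono (graphs n) fwd-bound ⟩
    ∑ (graphs n) (λ G → ∑³ (λ w a b → ⟦ N G ∧ forward G u v w a b ⟧) + ⟦ N G ⟧ * (suc j * E))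
      ≡⟨ trans (∑-distrib-+ (graphs n) _ _) (cong₂ _+_ (∑-∑³-comm {n = n} (graphs n) _) (sym (*-distribʳ-∑ (graphs n) _ _))) ⟩
    ∑³ (λ w a b → ∑ (graphs n) (λ G → ⟦ N G ∧ forward G u v w a b ⟧)) + #codegree n d u v (suc j) * (suc j * E)
      ≤⟨ +-monoˡ-≤ _ (∑³-mono switching) ⟩
    ∑³ (λ w a b → ∑ (graphs n) (λ G → ⟦ N′ G ∧ backward G u v w a b ⟧)) + #codegree n d u v (suc j) * (suc j * E)
      ≡⟨ cong (_+ #codegree n d u v (suc j) * (suc j * E)) (sym (∑-∑³-comm {n = n} (graphs n) _)) ⟩
    ∑ (graphs n) (λ G → ∑³ (λ w a b → ⟦ N′ G ∧ backward G u v w a b ⟧)) + #codegree n d u v (suc j) * (suc j * E)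
      ≤⟨ +-monoˡ-≤ _ (∑-mono (graphs n) bwd-bound) ⟩
    ∑ (graphs n) (λ G → ⟦ N′ G ⟧ * (d * (d * d))) + #codegree n d u v (suc j) * (suc j * E)
      ≡⟨ cong (_+ #codegree n d u v (suc j) * (suc j * E)) (sym (*-distribʳ-∑ (graphs n) _ _)) ⟩
    #codegree n d u v j * (d * (d * d)) + #codegree n d u v (suc j) * (suc j * E) ∎
    where
    open ≤-Reasoning
    E = 3 * (suc d * d)
    pull : ∀ (p : Bool) (f : Fin n → Fin n → Fin n → Bool) →
           ∑³ (λ w a b → ⟦ p ∧ f w a b ⟧) ≡ ⟦ p ⟧ * ∑³ (λ w a b → ⟦ f w a b ⟧)
    pull p f = trans
      (∑-cong (allFin n) λ w → ∑-cong (allFin n) λ a → ∑-cong (allFin n) λ b → ⟦⟧-∧ p (f w a b))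
      (sym (*-distribˡ-∑³ {n} ⟦ p ⟧ _))
    fwd-bound : ∀ G → ⟦ N G ⟧ * (suc j * (n * d)) ≤
      ∑³ (λ w a b → ⟦ N G ∧ forward G u v w a b ⟧) + ⟦ N G ⟧ * (suc j * E)
    fwd-bound G with N G in eq
    ... | false = z≤n
    ... | true  with ∧-true {isRegular d G} eq
    ... | reg , cod =
      subst₂ _≤_ (sym (*-identityˡ _)) (cong (∑³ (λ w a b → ⟦ forward G u v w a b ⟧) +_) (sym (*-identityˡ _)))
        (subst (λ J → J * (n * d) ≤ ∑³ (λ w a b → ⟦ forward G u v w a b ⟧) + J * E) (≡ᵇ-sound {codegree G u v} {suc j} cod)
          (forward-count (isRegular-sound {G = G} reg) u v))
    bwd-bound : ∀ G → ∑³ (λ w a b → ⟦ N′ G ∧ backward G u v w a b ⟧) ≤ ⟦ N′ G ⟧ * (d * (d * d))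
    bwd-bound G with N′ G in eq
    ... | false = ≤-reflexive (pull false (backward G u v))
    ... | true  = ≤-trans
      (≤-reflexive (backward-count (isRegular-sound {G = G} (proj₁ (∧-true {isRegular d G} eq))) u v))
      (≤-reflexive (sym (*-identityˡ _)))

-- The upper tail of the codegrees

#regular : ℕ → ℕ → ℕ
#regular n d = ∑ (graphs n) λ G → ⟦ isRegular d G ⟧

#codegree≤#regular : ∀ n d u v j → #codegree n d u v j ≤ #regular n d
#codegree≤#regular n d u v j = ∑-mono (graphs n) λ G → ⟦∧⟧≤ (isRegular d G) (codegree G u v ≡ᵇ j)
  where
  ⟦∧⟧≤ : ∀ p q → ⟦ p ∧ q ⟧ ≤ ⟦ p ⟧
  ⟦∧⟧≤ true  q = ⟦⟧≤1 q
  ⟦∧⟧≤ false q = z≤n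

module CodegreeTail (M n d : ℕ) (d>0 : 0 < d) (d≪n : 6 * (4 * M + 2) * d ≤ n) where

  -- From j ≥ (1 + 1/2M) d²/n on, the loss from inadmissible switchings is absorbed
  -- by n ≥ 6(4M+2)d and consecutive counts decrease by the factor 4M/(4M+1).
  Steep : ℕ → Set
  Steep j = (2 * M + 1) * (d * d) ≤ 2 * M * (n * j)

  private
    -- Since 3(d + 1) ≤ 6d ≤ n/(4M + 2), the switching inequality gives X j n (4M + 1)/(4M + 2) ≤ Y
    -- d². `Steep` contributes the factor (2M + 1)/(2M), and the product of the two fractions is (4M
    -- + 1)/(4M).
    decay-arithmetic : ∀ X Y j → X * (j * (n * d)) ≤ Y * (d * (d * d)) + X * (j * (3 * (suc d * d))) →
                       Steep j → (4 * M + 1) * X ≤ 4 * M * Y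
    decay-arithmetic X Y j switching steep = *-cancelʳ-≤ _ _ ((2 * M + 1) * (d * d)) {{nonZero}} (begin
      (4 * M + 1) * X * ((2 * M + 1) * (d * d))
        ≤⟨ *-monoʳ-≤ ((4 * M + 1) * X) steep ⟩
      (4 * M + 1) * X * (2 * M * (n * j))
        ≡⟨ e₁ M X n j ⟩
      2 * M * ((4 * M + 1) * (X * j * n))
        ≤⟨ *-monoʳ-≤ (2 * M) absorbed ⟩
      2 * M * ((4 * M + 2) * (Y * (d * d)))
        ≡⟨ e₂ M Y (d * d) ⟩
      4 * M * Y * ((2 * M + 1) * (d * d)) ∎)
      where
      open ≤-Reasoning
      e₁ : ∀ M X n j → (4 * M + 1) * X * (2 * M * (n * j)) ≡ 2 * M * ((4 * M + 1) * (X * j * n))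
      e₁ = solve-∀
      e₂ : ∀ M Y D → 2 * M * ((4 * M + 2) * (Y * D)) ≡ 4 * M * Y * ((2 * M + 1) * D)
      e₂ = solve-∀
      e₃ : ∀ X j n d → X * j * n * d ≡ X * (j * (n * d))
      e₃ = solve-∀
      e₄ : ∀ X Y j d → Y * (d * (d * d)) + X * (j * (3 * (suc d * d))) ≡ (Y * (d * d) + X * j * (3 * suc d)) * d
      e₄ = solve-∀
      e₅ : ∀ M A n → (4 * M + 1) * (A * n) + A * n ≡ (4 * M + 2) * (A * n)
      e₅ = solve-∀
      e₆ : ∀ M B A d → (4 * M + 2) * (B + A * (3 * (d + d))) ≡ (4 * M + 2) * B + A * (6 * (4 * M + 2) * d)
      e₆ = solve-∀
      nonZero : NonZero ((2 * M + 1) * (d * d))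
      nonZero = >-nonZero (*-mono-≤ (m≤n+m 1 (2 * M)) (*-mono-≤ d>0 d>0))
      per-arc : X * j * n ≤ Y * (d * d) + X * j * (3 * suc d)
      per-arc = *-cancelʳ-≤ _ _ d {{>-nonZero d>0}}
        (subst₂ _≤_ (sym (e₃ X j n d)) (e₄ X Y j d) switching)
      absorbed : (4 * M + 1) * (X * j * n) ≤ (4 * M + 2) * (Y * (d * d))
      absorbed = +-cancelʳ-≤ (X * j * n) _ _ (begin
        (4 * M + 1) * (X * j * n) + X * j * n
          ≡⟨ e₅ M (X * j) n ⟩
        (4 * M + 2) * (X * j * n)
          ≤⟨ *-monoʳ-≤ (4 * M + 2) per-arc ⟩
        (4 * M + 2) * (Y * (d * d) + X * j * (3 * suc d))
          ≤⟨ *-monoʳ-≤ (4 * M + 2) (+-monoʳ-≤ (Y * (d * d)) (*-monoʳ-≤ (X * j) (*-monoʳ-≤ 3 (+-monoˡ-≤ d d>0)))) ⟩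
        (4 * M + 2) * (Y * (d * d) + X * j * (3 * (d + d)))
          ≡⟨ e₆ M (Y * (d * d)) (X * j) d ⟩
        (4 * M + 2) * (Y * (d * d)) + X * j * (6 * (4 * M + 2) * d)
          ≤⟨ +-monoʳ-≤ _ (*-monoʳ-≤ (X * j) d≪n) ⟩
        (4 * M + 2) * (Y * (d * d)) + X * j * n ∎)

    ¬steep-zero : ¬ Steep 0
    ¬steep-zero steep = <⇒≱ (*-mono-≤ (m≤n+m 1 (2 * M)) (*-mono-≤ d>0 d>0))
      (subst ((2 * M + 1) * (d * d) ≤_) (trans (cong (2 * M *_) (*-zeroʳ n)) (*-zeroʳ (2 * M))) steep)

  module _ {u v : Fin n} (u≢v : u ≢ v) where

    -- Every step down from `j` yields one factor, and the last count is bounded trivially by that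
    -- of all regular graphs. Codegree 0 is never steep, so the descent cannot run past it.
    #codegree-decay : ∀ t j → (∀ i → i < t → Steep (j ∸ i)) →
                      #codegree n d u v j * (4 * M + 1) ^ t ≤ (4 * M) ^ t * #regular n d
    #codegree-decay zero    j       steep =
      subst₂ _≤_ (sym (*-identityʳ _)) (sym (*-identityˡ _)) (#codegree≤#regular n d u v j)
    #codegree-decay (suc t) zero    steep = contradiction (steep 0 (s≤s z≤n)) ¬steep-zero
    #codegree-decay (suc t) (suc j) steep = begin
      #codegree n d u v (suc j) * ((4 * M + 1) * (4 * M + 1) ^ t)
        ≡⟨ e₁ (#codegree n d u v (suc j)) (4 * M + 1) _ ⟩
      (4 * M + 1) * #codegree n d u v (suc j) * (4 * M + 1) ^ t
        ≤⟨ *-monoˡ-≤ _ (decay-arithmetic (#codegree n d u v (suc j)) (#codegree n d u v j) (suc j)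
             (codegree-switching u≢v j) (steep 0 (s≤s z≤n))) ⟩
      4 * M * #codegree n d u v j * (4 * M + 1) ^ t
        ≡⟨ *-assoc (4 * M) _ _ ⟩
      4 * M * (#codegree n d u v j * (4 * M + 1) ^ t)
        ≤⟨ *-monoʳ-≤ (4 * M) (#codegree-decay t j λ i i<t → steep (suc i) (s≤s i<t)) ⟩
      4 * M * ((4 * M) ^ t * #regular n d)
        ≡⟨ sym (*-assoc (4 * M) _ _) ⟩
      4 * M * (4 * M) ^ t * #regular n d ∎
      where
      open ≤-Reasoning
      e₁ : ∀ a b c → a * (b * c) ≡ b * a * c
      e₁ = solve-∀

  Large : ℕ → Bool
  Large j = suc M * (d * d) <ᵇ M * (n * j)

  large-sound : ∀ {j} → Large j ≡ true → suc M * (d * d) < M * (n * j)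
  large-sound {j} eq = <ᵇ⇒< _ _ (Equivalence.from T-≡ eq)

  -- Between (1 + 1/2M) d²/n and (1 + 1/M) d²/n there is room for d²/(2Mn) steps.
  large⇒steep : ∀ {j t} → 2 * M * (n * t) ≤ d * d → suc M * (d * d) < M * (n * j) →
                ∀ i → i < t → Steep (j ∸ i)
  large⇒steep {j} {t} t-small large i i<t = +-cancelʳ-≤ (d * d) _ _ (begin
    (2 * M + 1) * (d * d) + d * d            ≡⟨ e₁ M (d * d) ⟩
    2 * (suc M * (d * d))                    ≤⟨ *-monoʳ-≤ 2 (<⇒≤ large) ⟩
    2 * (M * (n * j))                        ≤⟨ *-monoʳ-≤ 2 (*-monoʳ-≤ M (*-monoʳ-≤ n (m≤n+m∸n j i))) ⟩
    2 * (M * (n * (i + (j ∸ i))))            ≡⟨ e₂ M n i (j ∸ i) ⟩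
    2 * M * (n * (j ∸ i)) + 2 * M * (n * i)  ≤⟨ +-monoʳ-≤ _ (*-monoʳ-≤ (2 * M) (*-monoʳ-≤ n (<⇒≤ i<t))) ⟩
    2 * M * (n * (j ∸ i)) + 2 * M * (n * t)  ≤⟨ +-monoʳ-≤ _ t-small ⟩
    2 * M * (n * (j ∸ i)) + d * d            ∎)
    where
    open ≤-Reasoning
    e₁ : ∀ M D → (2 * M + 1) * D + D ≡ 2 * (suc M * D)
    e₁ = solve-∀
    e₂ : ∀ M n i k → 2 * (M * (n * (i + k))) ≡ 2 * M * (n * k) + 2 * M * (n * i)
    e₂ = solve-∀

  #large : Adj n → ℕ
  #large G = ∑ᶠ λ u → ∑ᶠ λ v → ⟦ not (u == v) ∧ Large (codegree G u v) ⟧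

  isTypical : Adj n → Bool
  isTypical G = isRegular d G ∧ (#large G ≡ᵇ 0)

  typical-codegree : ∀ {G} → isTypical G ≡ true → ∀ {u v} → u ≢ v → M * (n * codegree G u v) ≤ suc M * (d * d)
  typical-codegree {G} typical {u} {v} u≢v = ≮⇒≥ λ large →
    0≢1+n (trans (sym zero-term) (cong ⟦_⟧ (cong₂ _∧_ (cong not (≢⇒==-false u≢v)) (Equivalence.to T-≡ (<⇒<ᵇ large)))))
    where
    zero-term : ⟦ not (u == v) ∧ Large (codegree G u v) ⟧ ≡ 0
    zero-term = ∑ᶠ≡0⇒≡0 (λ v → ⟦ not (u == v) ∧ Large (codegree G u v) ⟧) (∑ᶠ≡0⇒≡0 _
      (≡ᵇ-sound (proj₂ (∧-true {isRegular d G} typical))) u) v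

  codegree≤n : ∀ (G : Adj n) u v → codegree G u v ≤ n
  codegree≤n G u v = subst (codegree G u v ≤_) (*-identityʳ n)
    (∑-≤-const _ 1 λ j → *-mono-≤ (⟦⟧≤1 (G u j)) (⟦⟧≤1 (G v j)))

  private
    term : Fin n → Fin n → ℕ → Adj n → ℕ
    term u v j G = ⟦ not (u == v) ∧ Large j ⟧ * ⟦ hasCodegree d u v j G ⟧

    -- The union bound. Splitting by the value `j` of the codegree as well lets the decay be applied
    -- to one value at a time.
    regular-or-large : ∀ G → ⟦ isRegular d G ⟧ ≤
      ⟦ isTypical G ⟧ + ∑ᶠ λ u → ∑ᶠ λ v → ∑ (upTo (suc n)) λ j → term u v j G
    regular-or-large G with isRegular d G
    ... | false = z≤n
    ... | true  with #large G in eq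
    ...   | zero  = s≤s z≤n
    ...   | suc l = ≤-trans (s≤s z≤n) (subst (_≤ ∑ᶠ λ u → ∑ᶠ λ v → ∑ (upTo (suc n)) λ j →
                      ⟦ not (u == v) ∧ Large j ⟧ * ⟦ codegree G u v ≡ᵇ j ⟧) eq
                    (∑-mono (allFin n) λ u → ∑-mono (allFin n) λ v → at-codegree u v))
      where
      at-codegree : ∀ u v → ⟦ not (u == v) ∧ Large (codegree G u v) ⟧ ≤
        ∑ (upTo (suc n)) λ j → ⟦ not (u == v) ∧ Large j ⟧ * ⟦ codegree G u v ≡ᵇ j ⟧
      at-codegree u v = ≤-trans
        (≤-reflexive (sym (trans (cong (λ b → ⟦ not (u == v) ∧ Large (codegree G u v) ⟧ * ⟦ b ⟧) (≡ᵇ-complete {codegree G u v} refl))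
                                 (*-identityʳ _))))
        (≤-∑ (λ j → ⟦ not (u == v) ∧ Large j ⟧ * ⟦ codegree G u v ≡ᵇ j ⟧) (∈-upTo⁺ (s≤s (codegree≤n G u v))))

  #typical : ℕ
  #typical = ∑ (graphs n) λ G → ⟦ isTypical G ⟧

  #regular-bound : ∀ t → 2 * M * (n * t) ≤ d * d →
    #regular n d * (4 * M + 1) ^ t ≤ #typical * (4 * M + 1) ^ t + n * (n * (suc n * ((4 * M) ^ t * #regular n d)))
  #regular-bound t t-small = begin
    #regular n d * P
      ≤⟨ *-monoˡ-≤ P (∑-mono (graphs n) regular-or-large) ⟩
    ∑ (graphs n) (λ G → ⟦ isTypical G ⟧ + ∑ᶠ λ u → ∑ᶠ λ v → ∑ (upTo (suc n)) λ j → term u v j G) * P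
      ≡⟨ cong (_* P) (trans (∑-distrib-+ (graphs n) _ _) (cong (#typical +_)
           (trans (∑-comm (graphs n) (allFin n) _) (∑-cong (allFin n) λ u →
            trans (∑-comm (graphs n) (allFin n) _) (∑-cong (allFin n) λ v →
            ∑-comm (graphs n) (upTo (suc n)) _))))) ⟩
    (#typical + ∑ᶠ λ u → ∑ᶠ λ v → ∑ (upTo (suc n)) λ j → ∑ (graphs n) (term u v j)) * P
      ≡⟨ *-distribʳ-+ P #typical _ ⟩
    #typical * P + (∑ᶠ λ u → ∑ᶠ λ v → ∑ (upTo (suc n)) λ j → ∑ (graphs n) (term u v j)) * P
      ≡⟨ cong (#typical * P +_)
          (trans (*-distribʳ-∑ (allFin n) P _) (∑-cong (allFin n) λ u →
           trans (*-distribʳ-∑ (allFin n) P _) (∑-cong (allFin n) λ v →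
           *-distribʳ-∑ (upTo (suc n)) P λ j → ∑ (graphs n) (term u v j)))) ⟩
    #typical * P + (∑ᶠ λ u → ∑ᶠ λ v → ∑ (upTo (suc n)) λ j → ∑ (graphs n) (term u v j) * P)
      ≤⟨ +-monoʳ-≤ (#typical * P)
          (∑-≤-const _ _ λ u → ∑-≤-const _ _ λ v → ≤-trans (∑-mono (upTo (suc n)) (rare u v))
            (≤-reflexive (trans (∑-const (upTo (suc n)) Q) (cong (_* Q) (length-upTo (suc n)))))) ⟩
    #typical * P + n * (n * (suc n * Q)) ∎
    where
    open ≤-Reasoning
    P = (4 * M + 1) ^ t
    Q = (4 * M) ^ t * #regular n d
    rare : ∀ u v j → ∑ (graphs n) (term u v j) * P ≤ Q
    rare u v j with u ≟ v
    ... | yes _  = ≤-trans (≤-reflexive (cong (_* P) (trans (∑-const (graphs n) 0) (*-zeroʳ (length (graphs n)))))) z≤n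
    ... | no u≢v with Large j in large
    ...   | false = ≤-trans (≤-reflexive (cong (_* P) (trans (∑-const (graphs n) 0) (*-zeroʳ (length (graphs n)))))) z≤n
    ...   | true  = ≤-trans (≤-reflexive (cong (_* P) (∑-cong (graphs n) λ G → +-identityʳ _)))
                      (#codegree-decay u≢v t j (large⇒steep {j} {t} t-small (large-sound {j} large)))

  -- By `small` the atypical graphs are at most the fraction 1/(k + 1) of the regular ones. Adding
  -- `R` on both sides avoids subtraction, and multiplying by `P` avoids division.
  typical-proportion : ∀ k t → 2 * M * (n * t) ≤ d * d →
    suc k * (n * (n * (suc n * (4 * M) ^ t))) ≤ (4 * M + 1) ^ t →
    k * #regular n d ≤ suc k * #typical
  typical-proportion k t t-small small = +-cancelʳ-≤ R _ _ (*-cancelʳ-≤ _ _ P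
    {{>-nonZero (m^n>0 (4 * M + 1) {{>-nonZero (m≤n+m 1 (4 * M))}} t)}} (begin
    (k * R + R) * P
      ≡⟨ e₁ k R P ⟩
    suc k * (R * P)
      ≤⟨ *-monoʳ-≤ (suc k) (#regular-bound t t-small) ⟩
    suc k * (#typical * P + n * (n * (suc n * ((4 * M) ^ t * R))))
      ≡⟨ e₂ k #typical P n ((4 * M) ^ t) R ⟩
    suc k * #typical * P + suc k * (n * (n * (suc n * (4 * M) ^ t))) * R
      ≤⟨ +-monoʳ-≤ (suc k * #typical * P) (*-monoˡ-≤ R small) ⟩
    suc k * #typical * P + P * R
      ≡⟨ e₃ (suc k * #typical) P R ⟩
    (suc k * #typical + R) * P ∎))
    where
    open ≤-Reasoning
    P = (4 * M + 1) ^ t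
    R = #regular n d
    e₁ : ∀ k R P → (k * R + R) * P ≡ suc k * (R * P)
    e₁ = solve-∀
    e₂ : ∀ k A P n q R → suc k * (A * P + n * (n * (suc n * (q * R)))) ≡
                         suc k * A * P + suc k * (n * (n * (suc n * q))) * R
    e₂ = solve-∀
    e₃ : ∀ A P R → A * P + P * R ≡ (A + R) * P
    e₃ = solve-∀

-- Colourings

2xy≤x²+y² : ∀ x y → 2 * (x * y) ≤ x * x + y * y
2xy≤x²+y² x y with ≤-total x y
... | inj₁ x≤y = subst (λ z → 2 * (x * z) ≤ x * x + z * z) (m+[n∸m]≡n x≤y)
                   (≤-trans (m≤m+n _ ((y ∸ x) * (y ∸ x))) (≤-reflexive (square x (y ∸ x))))
  where
  square : ∀ x k → 2 * (x * (x + k)) + k * k ≡ x * x + (x + k) * (x + k)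
  square = solve-∀
... | inj₂ y≤x = subst (λ z → 2 * (z * y) ≤ z * z + y * y) (m+[n∸m]≡n y≤x)
                   (≤-trans (m≤m+n _ ((x ∸ y) * (x ∸ y))) (≤-reflexive (square y (x ∸ y))))
  where
  square : ∀ y k → 2 * ((y + k) * y) + k * k ≡ (y + k) * (y + k) + y * y
  square = solve-∀

∑ᶠ-*-∑ᶠ : ∀ {m n} (f : Fin m → ℕ) (g : Fin n → ℕ) → ∑ᶠ f * ∑ᶠ g ≡ ∑ᶠ λ i → ∑ᶠ λ j → f i * g j
∑ᶠ-*-∑ᶠ {m} {n} f g = trans (*-distribʳ-∑ (allFin m) (∑ᶠ g) f)
  (∑-cong (allFin m) λ i → *-distribˡ-∑ (allFin n) (f i) g)

-- Sum `2xy≤x²+y²` over all pairs in the support. Having the size of the support in place of `n` is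
-- essential: below, the support lies outside an independent set, and the vertices missing from it
-- produce the contradiction.
cauchy-schwarz : ∀ {n} (D : Fin n → ℕ) (p : Fin n → Bool) → (∀ i → p i ≡ false → D i ≡ 0) →
                 ∑ᶠ D * ∑ᶠ D ≤ ∑ᶠ (λ i → ⟦ p i ⟧) * ∑ᶠ (λ i → D i * D i)
cauchy-schwarz {n} D p support = *-cancelˡ-≤ 2 (begin
  2 * (∑ᶠ D * ∑ᶠ D)
    ≡⟨ cong (2 *_) (∑ᶠ-*-∑ᶠ D D) ⟩
  2 * ∑ᶠ (λ i → ∑ᶠ λ j → D i * D j)
    ≡⟨ trans (*-distribˡ-∑ (allFin n) 2 _) (∑-cong (allFin n) λ i → *-distribˡ-∑ (allFin n) 2 _) ⟩
  ∑ᶠ (λ i → ∑ᶠ λ j → 2 * (D i * D j))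
    ≤⟨ ∑-mono (allFin n) (λ i → ∑-mono (allFin n) λ j → pointwise i j) ⟩
  ∑ᶠ (λ i → ∑ᶠ λ j → ⟦ p i ⟧ * D² j + D² i * ⟦ p j ⟧)
    ≡⟨ trans (∑-cong (allFin n) λ i → ∑-distrib-+ (allFin n) (λ j → ⟦ p i ⟧ * D² j) _)
             (∑-distrib-+ (allFin n) (λ i → ∑ᶠ λ j → ⟦ p i ⟧ * D² j) _) ⟩
  ∑ᶠ (λ i → ∑ᶠ λ j → ⟦ p i ⟧ * D² j) + ∑ᶠ (λ i → ∑ᶠ λ j → D² i * ⟦ p j ⟧)
    ≡⟨ cong₂ _+_ (sym (∑ᶠ-*-∑ᶠ (λ i → ⟦ p i ⟧) D²)) (sym (∑ᶠ-*-∑ᶠ D² (λ i → ⟦ p i ⟧))) ⟩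
  |p| * ∑ᶠ D² + ∑ᶠ D² * |p|
    ≡⟨ cong (|p| * ∑ᶠ D² +_) (trans (*-comm (∑ᶠ D²) |p|) (sym (+-identityʳ _))) ⟩
  2 * (|p| * ∑ᶠ D²) ∎)
  where
  open ≤-Reasoning
  D² : Fin n → ℕ
  D² i = D i * D i
  |p| = ∑ᶠ λ i → ⟦ p i ⟧
  pointwise : ∀ i j → 2 * (D i * D j) ≤ ⟦ p i ⟧ * D² j + D² i * ⟦ p j ⟧
  pointwise i j with p i in pi | p j in pj
  ... | false | _     rewrite support i pi = z≤n
  ... | true  | false rewrite support j pj | *-zeroʳ (D i) = z≤n
  ... | true  | true  = ≤-trans (2xy≤x²+y² (D i) (D j))
    (≤-reflexive (trans (+-comm (D² i) (D² j)) (cong₂ _+_ (sym (+-identityʳ (D² j))) (sym (*-identityʳ (D² i))))))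

module _ {n d} {G : Adj n} (regular : Regular d G) where

  open RegularGraph regular

  codegree-self : ∀ x → codegree G x x ≡ d
  codegree-self x = trans (∑-cong (allFin n) λ j → idem (G x j)) (deg-G x)
    where
    idem : ∀ b → ⟦ b ⟧ * ⟦ b ⟧ ≡ ⟦ b ⟧
    idem true  = refl
    idem false = refl

  module _ (K L : ℕ) (codegrees : ∀ {x y} → x ≢ y → K * codegree G x y ≤ L)
           (S : Fin n → Bool) (independent : ∀ {x y} → S x ≡ true → S y ≡ true → G x y ≡ false) where

    private
      s = ∑ᶠ λ x → ⟦ S x ⟧
      s̅ = ∑ᶠ λ x → ⟦ not (S x) ⟧

      D : Fin n → ℕ
      D a = ∑ᶠ λ x → ⟦ S x ⟧ * ⟦ G x a ⟧

      ∑D : ∑ᶠ D ≡ s * d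
      ∑D = trans (∑-comm (allFin n) (allFin n) _) (∑-arcs-from regular (λ x → ⟦ S x ⟧))

      D-outside : ∀ a → not (S a) ≡ false → D a ≡ 0
      D-outside a a∈S = trans (∑-cong (allFin n) vanish) (trans (∑ᶠ-const {n} 0) (*-zeroʳ n))
        where
        not-false : ∀ {b} → not b ≡ false → b ≡ true
        not-false {true} _ = refl
        vanish : ∀ x → ⟦ S x ⟧ * ⟦ G x a ⟧ ≡ 0
        vanish x with S x in x∈S
        ... | false = refl
        ... | true  rewrite independent x∈S (not-false a∈S) = refl

      ∑D² : ∑ᶠ (λ a → D a * D a) ≡ ∑ᶠ λ x → ∑ᶠ λ y → ⟦ S x ⟧ * (⟦ S y ⟧ * codegree G x y)
      ∑D² = begin
        ∑ᶠ (λ a → D a * D a)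
          ≡⟨ ∑-cong (allFin n) (λ a → ∑ᶠ-*-∑ᶠ (λ x → ⟦ S x ⟧ * ⟦ G x a ⟧) (λ y → ⟦ S y ⟧ * ⟦ G y a ⟧)) ⟩
        ∑ᶠ (λ a → ∑ᶠ λ x → ∑ᶠ λ y → ⟦ S x ⟧ * ⟦ G x a ⟧ * (⟦ S y ⟧ * ⟦ G y a ⟧))
          ≡⟨ trans (∑-comm (allFin n) (allFin n) _) (∑-cong (allFin n) λ x → ∑-comm (allFin n) (allFin n) _) ⟩
        ∑ᶠ (λ x → ∑ᶠ λ y → ∑ᶠ λ a → ⟦ S x ⟧ * ⟦ G x a ⟧ * (⟦ S y ⟧ * ⟦ G y a ⟧))
          ≡⟨ ∑-cong (allFin n) (λ x → ∑-cong (allFin n) λ y → trans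
               (∑-cong (allFin n) λ a → rearrange ⟦ S x ⟧ ⟦ G x a ⟧ ⟦ S y ⟧ ⟦ G y a ⟧)
               (sym (trans (cong (⟦ S x ⟧ *_) (*-distribˡ-∑ (allFin n) ⟦ S y ⟧ _)) (*-distribˡ-∑ (allFin n) ⟦ S x ⟧ _)))) ⟩
        ∑ᶠ (λ x → ∑ᶠ λ y → ⟦ S x ⟧ * (⟦ S y ⟧ * codegree G x y)) ∎
        where
        open ≡-Reasoning
        rearrange : ∀ p g q h → p * g * (q * h) ≡ p * (q * (g * h))
        rearrange = solve-∀

      -- The second moment counts pairs in `S` by codegree: the diagonal contributes `d` per vertex,
      -- any other pair at most `L / K`. Charging the diagonal pairs `L` as well is harmless.
      K∑D² : K * ∑ᶠ (λ a → D a * D a) ≤ s * (K * d) + s * (s * L)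
      K∑D² = begin
        K * ∑ᶠ (λ a → D a * D a)
          ≡⟨ cong (K *_) ∑D² ⟩
        K * ∑ᶠ (λ x → ∑ᶠ λ y → ⟦ S x ⟧ * (⟦ S y ⟧ * codegree G x y))
          ≡⟨ trans (*-distribˡ-∑ (allFin n) K _) (∑-cong (allFin n) λ x → *-distribˡ-∑ (allFin n) K _) ⟩
        ∑ᶠ (λ x → ∑ᶠ λ y → K * (⟦ S x ⟧ * (⟦ S y ⟧ * codegree G x y)))
          ≤⟨ ∑-mono (allFin n) (λ x → row x) ⟩
        ∑ᶠ (λ x → ⟦ S x ⟧ * (K * d + s * L))
          ≡⟨ trans (sym (*-distribʳ-∑ (allFin n) _ (λ x → ⟦ S x ⟧))) (*-distribˡ-+ s (K * d) (s * L)) ⟩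
        s * (K * d) + s * (s * L) ∎
        where
        open ≤-Reasoning
        rearrange : ∀ K p q c → K * (p * (q * c)) ≡ p * (q * (K * c))
        rearrange = solve-∀
        pair : ∀ x y → ⟦ S y ⟧ * (K * codegree G x y) ≤ ⟦ y == x ⟧ * (K * d) + ⟦ S y ⟧ * L
        pair x y = by-cases (y ≟ x)
          where
          by-cases : Dec (y ≡ x) → ⟦ S y ⟧ * (K * codegree G x y) ≤ ⟦ y == x ⟧ * (K * d) + ⟦ S y ⟧ * L
          by-cases (no y≢x)   = ≤-trans (*-monoʳ-≤ ⟦ S y ⟧ (codegrees (y≢x ∘ sym))) (m≤n+m _ _)
          by-cases (yes refl) = ≤-trans (*-mono-≤ (⟦⟧≤1 (S x)) (≤-reflexive (cong (K *_) (codegree-self x))))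
            (≤-trans (≤-reflexive (cong (λ b → ⟦ b ⟧ * (K * d)) (sym (==-refl x)))) (m≤m+n _ _))
        row : ∀ x → ∑ᶠ (λ y → K * (⟦ S x ⟧ * (⟦ S y ⟧ * codegree G x y))) ≤ ⟦ S x ⟧ * (K * d + s * L)
        row x = begin
          ∑ᶠ (λ y → K * (⟦ S x ⟧ * (⟦ S y ⟧ * codegree G x y)))
            ≡⟨ trans (∑-cong (allFin n) λ y → rearrange K ⟦ S x ⟧ ⟦ S y ⟧ (codegree G x y)) (sym (*-distribˡ-∑ (allFin n) ⟦ S x ⟧ _)) ⟩
          ⟦ S x ⟧ * ∑ᶠ (λ y → ⟦ S y ⟧ * (K * codegree G x y))
            ≤⟨ *-monoʳ-≤ ⟦ S x ⟧ (∑-mono (allFin n) (pair x)) ⟩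
          ⟦ S x ⟧ * ∑ᶠ (λ y → ⟦ y == x ⟧ * (K * d) + ⟦ S y ⟧ * L)
            ≡⟨ cong (⟦ S x ⟧ *_) (trans (∑-distrib-+ (allFin n) (λ y → ⟦ y == x ⟧ * (K * d)) _)
                 (cong₂ _+_ (∑ᶠ-δ* x (λ _ → K * d)) (sym (*-distribʳ-∑ (allFin n) L _)))) ⟩
          ⟦ S x ⟧ * (K * d + s * L) ∎

    independent-complement : s + s̅ ≡ n
    independent-complement = trans (sym (∑-distrib-+ (allFin n) (λ x → ⟦ S x ⟧) _))
      (trans (∑-cong (allFin n) λ x → one (S x)) (trans (∑ᶠ-const {n} 1) (*-identityʳ n)))
      where
      one : ∀ b → ⟦ b ⟧ + ⟦ not b ⟧ ≡ 1
      one true  = refl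
      one false = refl

    independent-bound : K * (s * d * (s * d)) ≤ s̅ * (s * (K * d) + s * (s * L))
    independent-bound = begin
      K * (s * d * (s * d))
        ≡⟨ cong (λ z → K * (z * z)) (sym ∑D) ⟩
      K * (∑ᶠ D * ∑ᶠ D)
        ≤⟨ *-monoʳ-≤ K (cauchy-schwarz D (not ∘ S) D-outside) ⟩
      K * (s̅ * ∑ᶠ (λ a → D a * D a))
        ≡⟨ trans (sym (*-assoc K s̅ _)) (trans (cong (_* ∑ᶠ (λ a → D a * D a)) (*-comm K s̅)) (*-assoc s̅ K _)) ⟩
      s̅ * (K * ∑ᶠ (λ a → D a * D a))
        ≤⟨ *-monoʳ-≤ s̅ K∑D² ⟩
      s̅ * (s * (K * d) + s * (s * L)) ∎
      where open ≤-Reasoning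

  -- A colour class of at least average size `s` has `n ≤ c * s`. For codegrees up to (1 + 1/2c)
  -- d²/n, `independent-bound` yields (2c + 1) s² d ≤ 2c n² + n s d after a term is discarded. As 2c
  -- s² d ≥ 2 n s d, this leaves s d ≤ 2c n ≤ 2c² s, hence d ≤ 2c².
  ¬colorable : ∀ c → 0 < n → 2 * (c * c) < d →
               (∀ {x y} → x ≢ y → 2 * c * (n * codegree G x y) ≤ suc (2 * c) * (d * d)) → ¬ Colorable c G
  ¬colorable zero     n>0 c≪d codegrees (f , proper) with f (fromℕ< n>0)
  ... | ()
  ¬colorable c@(suc _) n>0 c≪d codegrees (f , proper) with ∃-above-average _ (λ κ → ∑ᶠ λ x → ⟦ f x == κ ⟧)
  ... | κ , large = <⇒≱ c≪d (*-cancelˡ-≤ s {{>-nonZero s>0}} (begin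
      s * d              ≤⟨ *-cancelˡ-≤ n {{>-nonZero n>0}} nsd ⟩
      2 * c * n          ≤⟨ *-monoʳ-≤ (2 * c) n≤cs ⟩
      2 * c * (c * s)    ≡⟨ e₁ c s ⟩
      s * (2 * (c * c))  ∎))
    where
    open ≤-Reasoning
    e₁ : ∀ c s → 2 * c * (c * s) ≡ s * (2 * (c * c))
    e₁ = solve-∀
    e₂ : ∀ K s d → K * (s * d * (s * d)) ≡ K * s * d * (s * d)
    e₂ = solve-∀
    e₃ : ∀ t s M n d → t * (s * (M * n * d) + s * (s * (suc M * (d * d)))) ≡ t * (M * n + s * (suc M * d)) * (s * d)
    e₃ = solve-∀
    e₄ : ∀ c s n d → 2 * c * n * s * d + s * (s * (suc (2 * c) * d)) ≡ 2 * c * n * s * d + (2 * (c * s) * (s * d) + s * s * d)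
    e₄ = solve-∀
    e₅ : ∀ t s M n d → t * (M * n + s * (suc M * d)) + s * (s * (suc M * d)) ≡ t * (M * n) + (s + t) * (s * (suc M * d))
    e₅ = solve-∀
    e₆ : ∀ M n s d → n * (M * n) + n * (s * (suc M * d)) ≡ M * n * s * d + (n * (M * n) + n * (s * d))
    e₆ = solve-∀
    e₇ : ∀ n z → n * z + n * z ≡ 2 * n * z
    e₇ = solve-∀
    S : Fin n → Bool
    S x = f x == κ
    s = ∑ᶠ λ x → ⟦ S x ⟧
    s̅ = ∑ᶠ λ x → ⟦ not (S x) ⟧
    independent : ∀ {x y} → S x ≡ true → S y ≡ true → G x y ≡ false
    independent {x} {y} x∈S y∈S with G x y in edge
    ... | false = refl
    ... | true  = contradiction (trans (==-true⇒≡ x∈S) (sym (==-true⇒≡ y∈S))) (proper x y edge)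
    codegrees′ : ∀ {x y} → x ≢ y → 2 * c * n * codegree G x y ≤ suc (2 * c) * (d * d)
    codegrees′ x≢y = ≤-trans (≤-reflexive (*-assoc (2 * c) n _)) (codegrees x≢y)
    n≤cs : n ≤ c * s
    n≤cs = subst (_≤ c * s) (trans (∑-comm (allFin c) (allFin n) _)
      (trans (∑-cong (allFin n) λ x → trans (∑-cong (allFin c) λ κ → cong ⟦_⟧ (==-sym (f x) κ)) (∑ᶠ-δ (f x)))
             (trans (∑ᶠ-const {n} 1) (*-identityʳ n)))) large
    s>0 : 0 < s
    s>0 = n≢0⇒n>0 λ s≡0 → <⇒≱ n>0 (subst (n ≤_) (trans (cong (c *_) s≡0) (*-zeroʳ c)) n≤cs)
    sd>0 : 0 < s * d
    sd>0 = *-mono-≤ s>0 (≤-trans (s≤s z≤n) c≪d)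
    s+s̅≡n : s + s̅ ≡ n
    s+s̅≡n = independent-complement 0 0 (λ _ → z≤n) S independent
    reduced : 2 * c * n * s * d ≤ s̅ * (2 * c * n + s * (suc (2 * c) * d))
    reduced = *-cancelʳ-≤ _ _ (s * d) {{>-nonZero sd>0}}
      (subst₂ _≤_ (e₂ (2 * c * n) s d) (e₃ s̅ s (2 * c) n d)
        (independent-bound (2 * c * n) (suc (2 * c) * (d * d)) codegrees′ S independent))
    -- Here `s̅ = n - s` is used without subtraction: the term quadratic in `s` is added to both
    -- sides, so that `s + s̅` appears.
    nsd : n * (s * d) ≤ n * (2 * c * n)
    nsd = +-cancelʳ-≤ (n * (s * d)) _ _ (+-cancelˡ-≤ (2 * c * n * s * d) _ _ (begin
      2 * c * n * s * d + (n * (s * d) + n * (s * d))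
        ≡⟨ cong (2 * c * n * s * d +_) (e₇ n (s * d)) ⟩
      2 * c * n * s * d + 2 * n * (s * d)
        ≤⟨ +-monoʳ-≤ _ (≤-trans (*-monoˡ-≤ (s * d) (*-monoʳ-≤ 2 n≤cs)) (m≤m+n _ (s * s * d))) ⟩
      2 * c * n * s * d + (2 * (c * s) * (s * d) + s * s * d)
        ≡⟨ sym (e₄ c s n d) ⟩
      2 * c * n * s * d + s * (s * (suc (2 * c) * d))
        ≤⟨ +-monoˡ-≤ _ reduced ⟩
      s̅ * (2 * c * n + s * (suc (2 * c) * d)) + s * (s * (suc (2 * c) * d))
        ≡⟨ e₅ s̅ s (2 * c) n d ⟩
      s̅ * (2 * c * n) + (s + s̅) * (s * (suc (2 * c) * d))
        ≤⟨ +-mono-≤ (*-monoˡ-≤ _ (≤-trans (m≤n+m s̅ s) (≤-reflexive s+s̅≡n))) (*-monoˡ-≤ _ (≤-reflexive s+s̅≡n)) ⟩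
      n * (2 * c * n) + n * (s * (suc (2 * c) * d))
        ≡⟨ e₆ (2 * c) n s d ⟩
      2 * c * n * s * d + (n * (2 * c * n) + n * (s * d)) ∎))

Colorable-mono : ∀ {n c c′} {G : Adj n} → c ≤ c′ → Colorable c G → Colorable c′ G
Colorable-mono c≤c′ (f , proper) =
  (λ x → inject≤ (f x) c≤c′) , λ i j e → proper i j e ∘ inject≤-injective c≤c′ c≤c′ (f i) (f j)

-- Frozen homomorphisms

0<∑ᶠ⇒∃ : ∀ {n} (f : Fin n → ℕ) → 0 < ∑ᶠ f → ∃ λ i → 0 < f i
0<∑ᶠ⇒∃ {suc n} f 0<∑ with ∃-above-average n f
... | i , ∑≤ = i , n≢0⇒n>0 λ fi≡0 →
  <⇒≱ 0<∑ (≤-trans ∑≤ (≤-reflexive (trans (cong (suc n *_) fi≡0) (*-zeroʳ (suc n)))))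

two-terms-≤-∑ᶠ : ∀ {n} (f : Fin n → ℕ) {i j} → i ≢ j → f i + f j ≤ ∑ᶠ f
two-terms-≤-∑ᶠ {n} f {i} {j} i≢j = begin
  f i + f j
    ≡⟨ cong₂ _+_ (sym (∑ᶠ-δ* i f)) (sym (∑ᶠ-δ* j f)) ⟩
  ∑ᶠ (λ k → ⟦ k == i ⟧ * f k) + ∑ᶠ (λ k → ⟦ k == j ⟧ * f k)
    ≡⟨ sym (∑-distrib-+ (allFin n) (λ k → ⟦ k == i ⟧ * f k) _) ⟩
  ∑ᶠ (λ k → ⟦ k == i ⟧ * f k + ⟦ k == j ⟧ * f k)
    ≤⟨ ∑-mono (allFin n) (λ k → ≤-trans (≤-reflexive (sym (*-distribʳ-+ (f k) ⟦ k == i ⟧ ⟦ k == j ⟧)))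
         (≤-trans (*-monoˡ-≤ (f k) (exclusive k)) (≤-reflexive (*-identityˡ (f k))))) ⟩
  ∑ᶠ f ∎
  where
  open ≤-Reasoning
  exclusive : ∀ k → ⟦ k == i ⟧ + ⟦ k == j ⟧ ≤ 1
  exclusive k with k ≟ i | k ≟ j
  ... | yes refl | yes k≡j = contradiction k≡j i≢j
  ... | yes _    | no _    = s≤s z≤n
  ... | no _     | b       = ⟦⟧≤1 (does b)

0<ᵇ-true : ∀ {k} → (0 <ᵇ k) ≡ true → 0 < k
0<ᵇ-true {suc k} _ = s≤s z≤n

⟦==⟧>0 : ∀ {n} {i j : Fin n} → 0 < ⟦ i == j ⟧ → i ≡ j
⟦==⟧>0 {i = i} {j} pos with i ≟ j
... | yes i≡j = i≡j

Star-from-isolated : ∀ {A : Set} {R : A → A → Set} {x y} → (∀ {z} → ¬ R x z) → Star R x y → x ≡ y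
Star-from-isolated isolated ε       = refl
Star-from-isolated isolated (r ◅ _) = contradiction r isolated

-- The left inverse makes each `step k` injective, so that a vertex has one successor and at most
-- one predecessor for each `k`; this bounds the degree by 2r. The change of `side` excludes loops
-- and provides the second homomorphism.
module FrozenHom {n m r} {G : Adj n} (simple : SimpleGraph G)
  (φ : Fin m → Fin n) (side : Fin m → Bool) (step back : Fin r → Fin m → Fin m)
  (back-step : ∀ k x → back k (step k x) ≡ x)
  (step-side : ∀ k x → side (step k x) ≡ not (side x))
  (step-edge : ∀ k x → G (φ x) (φ (step k x)) ≡ true)
  (pinned : ∀ x u → (∀ k → G u (φ (step k x)) ≡ true) → u ≡ φ x) where

  private
    sym-G = proj₁ simple

    weight : Fin m → Fin m → Fin r → ℕ
    weight x y k = ⟦ y == step k x ⟧ + ⟦ x == step k y ⟧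

  -- The undirected union of the `r` maps; parallel edges merge, hence the test for positive weight.
  H : Adj m
  H x y = 0 <ᵇ ∑ᶠ (weight x y)

  H-sound : ∀ {x y} → H x y ≡ true → ∃ λ k → y ≡ step k x ⊎ x ≡ step k y
  H-sound {x} {y} xy with 0<∑ᶠ⇒∃ (weight x y) (0<ᵇ-true xy)
  ... | k , pos with y ≟ step k x
  ... | yes y≡ = k , inj₁ y≡
  ... | no  _  = k , inj₂ (⟦==⟧>0 pos)

  private
    not-fixed : ∀ {b} → b ≢ not b
    not-fixed {true}  ()
    not-fixed {false} ()

  step-moves : ∀ {k x} → x ≢ step k x
  step-moves {k} {x} eq = not-fixed (trans (cong side eq) (step-side k x))

  H-complete : ∀ k x → H x (step k x) ≡ true
  H-complete k x = Equivalence.to T-≡ (<⇒<ᵇ (≤-trans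
    (subst (λ b → 1 ≤ ⟦ b ⟧ + ⟦ x == step k (step k x) ⟧) (sym (==-refl (step k x))) (s≤s z≤n))
    (≤-∑ᶠ (weight x (step k x)) k)))

  H-simple : SimpleGraph H
  H-simple = (λ x y → cong (0 <ᵇ_) (∑-cong (allFin r) λ k → +-comm ⟦ y == step k x ⟧ _)) , irreflexive
    where
    irreflexive : ∀ x → H x x ≡ false
    irreflexive x with H x x in xx
    ... | false = refl
    ... | true  with H-sound {x} {x} xx
    ... | k , inj₁ x≡ = contradiction x≡ step-moves
    ... | k , inj₂ x≡ = contradiction x≡ step-moves

  H-degree : ∀ x → degree H x ≤ r * 2
  H-degree x = begin
    degree H x
      ≤⟨ ∑-mono (allFin m) (λ y → ⟦0<ᵇ⟧≤ (∑ᶠ (weight x y))) ⟩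
    ∑ᶠ (λ y → ∑ᶠ (weight x y))
      ≡⟨ ∑-comm (allFin m) (allFin r) _ ⟩
    ∑ᶠ (λ k → ∑ᶠ λ y → weight x y k)
      ≤⟨ ∑-≤-const _ 2 two ⟩
    r * 2 ∎
    where
    open ≤-Reasoning
    ⟦0<ᵇ⟧≤ : ∀ k → ⟦ 0 <ᵇ k ⟧ ≤ k
    ⟦0<ᵇ⟧≤ zero    = z≤n
    ⟦0<ᵇ⟧≤ (suc k) = s≤s z≤n
    preimage : ∀ k y → ⟦ x == step k y ⟧ ≤ ⟦ y == back k x ⟧
    preimage k y with x ≟ step k y
    ... | no _     = z≤n
    ... | yes refl rewrite back-step k y | ==-refl y = s≤s z≤n
    two : ∀ k → ∑ᶠ (λ y → weight x y k) ≤ 2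
    two k = begin
      ∑ᶠ (λ y → weight x y k)
        ≡⟨ ∑-distrib-+ (allFin m) (λ y → ⟦ y == step k x ⟧) _ ⟩
      ∑ᶠ (λ y → ⟦ y == step k x ⟧) + ∑ᶠ (λ y → ⟦ x == step k y ⟧)
        ≤⟨ +-mono-≤ (≤-reflexive (∑ᶠ-δ (step k x))) (∑-mono (allFin m) (preimage k)) ⟩
      1 + ∑ᶠ (λ y → ⟦ y == back k x ⟧)
        ≡⟨ cong suc (∑ᶠ-δ (back k x)) ⟩
      2 ∎

  frozen : Hom H G
  frozen = φ , edge
    where
    edge : ∀ x y → H x y ≡ true → G (φ x) (φ y) ≡ true
    edge x y xy with H-sound {x} {y} xy
    ... | k , inj₁ refl = step-edge k x
    ... | k , inj₂ refl = trans (sym-G _ _) (step-edge k y)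

  -- No `step k x` equals `x`, so a change at `x` alone keeps the images of these neighbours. The
  -- new value is still adjacent to all of them, and `pinned` returns the old value.
  frozen-isolated : ∀ {ψ} → ¬ HomAdj {H = H} {G = G} frozen ψ
  frozen-isolated {ψ , edge} (x , φx≢ψx , agree) = φx≢ψx (sym (pinned x (ψ x) λ k →
    trans (cong (G (ψ x)) (agree (step k x) (step-moves ∘ sym))) (edge x (step k x) (H-complete k x))))

  module _ {a b} (ab : G a b ≡ true) where

    two-valued : Hom H G
    two-valued = ψ , edge
      where
      ψ : Fin m → Fin n
      ψ x = if side x then a else b
      flipped : ∀ s → G (if s then a else b) (if not s then a else b) ≡ true
      flipped true  = ab
      flipped false = trans (sym-G b a) ab
      step-ψ : ∀ k x → G (ψ x) (ψ (step k x)) ≡ true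
      step-ψ k x = trans (cong (λ s → G (ψ x) (if s then a else b)) (step-side k x)) (flipped (side x))
      edge : ∀ x y → H x y ≡ true → G (ψ x) (ψ y) ≡ true
      edge x y xy with H-sound {x} {y} xy
      ... | k , inj₁ refl = step-ψ k x
      ... | k , inj₂ refl = trans (sym-G _ _) (step-ψ k y)

    -- The vertex `x` tells the two maps apart: one sends it to `φ x`, the other to `a`. No path
    -- leaves an isolated vertex.
    ¬mobile : ∀ x → side x ≡ true → φ x ≢ a → ∀ k → r * 2 + 2 ≤ k → ¬ Mobile k G
    ¬mobile x x-side φx≢a k 2r+2≤k mobile = φx≢a (trans
      (cong (λ h → proj₁ h x) (Star-from-isolated {R = HomAdj {H = H} {G = G}} (λ {ψ} → frozen-isolated {ψ}) (connected frozen two-valued)))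
      (cong (λ s → if s then a else b) x-side))
      where
      connected : HomConnected H G
      connected = mobile m H H-simple λ y → ≤-trans (+-monoˡ-≤ 2 (H-degree y)) 2r+2≤k

-- Cyclic rotations and the arcs of a regular graph

module Rotation (d-1 : ℕ) where

  private
    d = suc d-1

  rotate unrotate : Fin d → Fin d → Fin d
  rotate   t i = (toℕ i + toℕ t) mod d
  unrotate t i = (toℕ i + (d ∸ toℕ t)) mod d

  toℕ-mod : ∀ k → toℕ (k mod d) ≡ k % d
  toℕ-mod k = toℕ-fromℕ< (m%n<n k d)

  mod-toℕ : ∀ (i : Fin d) → toℕ i mod d ≡ i
  mod-toℕ i = toℕ-injective (trans (toℕ-mod (toℕ i)) (m<n⇒m%n≡m (toℕ<n i)))

  unrotate-rotate : ∀ t i → unrotate t (rotate t i) ≡ i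
  unrotate-rotate t i = toℕ-injective (begin
    toℕ (unrotate t (rotate t i))
      ≡⟨ toℕ-mod (toℕ (rotate t i) + (d ∸ toℕ t)) ⟩
    (toℕ (rotate t i) + (d ∸ toℕ t)) % d
      ≡⟨ cong (λ z → (z + (d ∸ toℕ t)) % d) (toℕ-mod (toℕ i + toℕ t)) ⟩
    ((toℕ i + toℕ t) % d + (d ∸ toℕ t)) % d
      ≡⟨ %-distribˡ-+ ((toℕ i + toℕ t) % d) (d ∸ toℕ t) d ⟩
    ((toℕ i + toℕ t) % d % d + (d ∸ toℕ t) % d) % d
      ≡⟨ cong (λ z → (z + (d ∸ toℕ t) % d) % d) (m%n%n≡m%n (toℕ i + toℕ t) d) ⟩
    ((toℕ i + toℕ t) % d + (d ∸ toℕ t) % d) % d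
      ≡⟨ sym (%-distribˡ-+ (toℕ i + toℕ t) (d ∸ toℕ t) d) ⟩
    (toℕ i + toℕ t + (d ∸ toℕ t)) % d
      ≡⟨ cong (_% d) (trans (+-assoc (toℕ i) (toℕ t) _) (cong (toℕ i +_) (m+[n∸m]≡n (<⇒≤ (toℕ<n t))))) ⟩
    (toℕ i + d) % d
      ≡⟨ [m+n]%n≡m%n (toℕ i) d ⟩
    toℕ i % d
      ≡⟨ m<n⇒m%n≡m (toℕ<n i) ⟩
    toℕ i ∎)
    where open ≡-Reasoning

  private
    ∑-shift : ∀ n (F : ℕ → ℕ) → ∑ᶠ {n} (λ t → F (suc (toℕ t))) + F 0 ≡ ∑ᶠ {n} (F ∘ toℕ) + F n
    ∑-shift zero    F = refl
    ∑-shift (suc n) F = begin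
      ∑ᶠ {suc n} (λ t → F (suc (toℕ t))) + F 0
        ≡⟨ cong (_+ F 0) (trans (∑ᶠ-suc {n} λ t → F (suc (toℕ t))) (+-comm (F 1) _)) ⟩
      ∑ᶠ {n} (λ t → F (suc (suc (toℕ t)))) + F 1 + F 0
        ≡⟨ cong (_+ F 0) (∑-shift n (F ∘ suc)) ⟩
      ∑ᶠ {n} (λ t → F (suc (toℕ t))) + F (suc n) + F 0
        ≡⟨ comm (∑ᶠ {n} (λ t → F (suc (toℕ t)))) (F (suc n)) (F 0) ⟩
      F 0 + ∑ᶠ {n} (λ t → F (suc (toℕ t))) + F (suc n)
        ≡⟨ cong (_+ F (suc n)) (sym (∑ᶠ-suc {n} (F ∘ toℕ))) ⟩
      ∑ᶠ {suc n} (F ∘ toℕ) + F (suc n) ∎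
      where
      open ≡-Reasoning
      comm : ∀ a b c → a + b + c ≡ c + a + b
      comm = solve-∀

    -- Sliding the window by one place trades its first value for the one a full period later, which
    -- is equal.
    ∑-period : ∀ (F : ℕ → ℕ) → (∀ k → F (k + d) ≡ F k) → ∀ s → ∑ᶠ {d} (λ t → F (s + toℕ t)) ≡ ∑ᶠ {d} (F ∘ toℕ)
    ∑-period F periodic zero    = refl
    ∑-period F periodic (suc s) = trans (+-cancelʳ-≡ (F s) _ _ (begin
      ∑ᶠ {d} (λ t → F (suc s + toℕ t)) + F s
        ≡⟨ cong₂ _+_ (∑-cong (allFin d) λ t → cong F (sym (+-suc s (toℕ t)))) (cong F (sym (+-identityʳ s))) ⟩
      ∑ᶠ {d} (λ t → F (s + suc (toℕ t))) + F (s + 0)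
        ≡⟨ ∑-shift d (λ k → F (s + k)) ⟩
      ∑ᶠ {d} (λ t → F (s + toℕ t)) + F (s + d)
        ≡⟨ cong (∑ᶠ {d} (λ t → F (s + toℕ t)) +_) (periodic s) ⟩
      ∑ᶠ {d} (λ t → F (s + toℕ t)) + F s ∎)) (∑-period F periodic s)
      where open ≡-Reasoning

  ∑-rotate : ∀ (g : Fin d → ℕ) i → ∑ᶠ (λ t → g (rotate t i)) ≡ ∑ᶠ g
  ∑-rotate g i = trans (∑-period (λ k → g (k mod d)) periodic (toℕ i))
                       (∑-cong (allFin d) λ t → cong g (mod-toℕ t))
    where
    periodic : ∀ k → g ((k + d) mod d) ≡ g (k mod d)
    periodic k = cong g (toℕ-injective (trans (toℕ-mod (k + d)) (trans ([m+n]%n≡m%n k d) (sym (toℕ-mod k)))))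

-- The formulation by sums is what gets used: on indicator functions it shows that ports lead to
-- neighbours, to all of them, and to each only once.
enumerate : ∀ {A : Set} (xs : List A) {d} → length xs ≡ d → ∃ λ (e : Fin d → A) → ∀ g → ∑ᶠ (g ∘ e) ≡ ∑ xs g
enumerate xs refl = lookup xs , λ g → cong sum (begin
  map (g ∘ lookup xs) (tabulate id)  ≡⟨ map-tabulate id (g ∘ lookup xs) ⟩
  tabulate (g ∘ lookup xs)           ≡⟨ sym (map-tabulate (lookup xs) g) ⟩
  map g (tabulate (lookup xs))       ≡⟨ cong (map g) (tabulate-lookup xs) ⟩
  map g xs                           ∎)
  where open ≡-Reasoning

module _ {n d} {G : Adj n} (regular : Regular d G) where

  open RegularGraph regular

  private
    neighbours : ∀ v → ∃ λ (e : Fin d → Fin n) → ∀ g → ∑ᶠ (g ∘ e) ≡ ∑ (filterᵇ (G v) (allFin n)) g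
    neighbours v = enumerate (filterᵇ (G v) (allFin n)) (trans (length-filterᵇ (G v) (allFin n)) (deg-G v))

  neighbour : Fin n → Fin d → Fin n
  neighbour v = proj₁ (neighbours v)

  ∑-neighbour : ∀ v (g : Fin n → ℕ) → ∑ᶠ (λ i → g (neighbour v i)) ≡ ∑ᶠ λ w → ⟦ G v w ⟧ * g w
  ∑-neighbour v g = trans (proj₂ (neighbours v) g) (∑-filterᵇ (G v) (allFin n) g)

  neighbour-edge : ∀ v i → G v (neighbour v i) ≡ true
  neighbour-edge v i = ⟦not⟧≡0 (G v (neighbour v i)) (∑ᶠ≡0⇒≡0 (λ i → ⟦ not (G v (neighbour v i)) ⟧)
    (trans (∑-neighbour v λ w → ⟦ not (G v w) ⟧)
           (trans (∑-cong (allFin n) λ w → cancel (G v w)) (trans (∑ᶠ-const {n} 0) (*-zeroʳ n)))) i)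
    where
    ⟦not⟧≡0 : ∀ b → ⟦ not b ⟧ ≡ 0 → b ≡ true
    ⟦not⟧≡0 true _ = refl
    cancel : ∀ b → ⟦ b ⟧ * ⟦ not b ⟧ ≡ 0
    cancel true  = refl
    cancel false = refl

  private
    ∑-neighbour-δ : ∀ v w → ∑ᶠ (λ i → ⟦ neighbour v i == w ⟧) ≡ ⟦ G v w ⟧
    ∑-neighbour-δ v w = trans (∑-neighbour v (λ z → ⟦ z == w ⟧))
      (trans (∑-cong (allFin n) λ z → *-comm ⟦ G v z ⟧ ⟦ z == w ⟧) (∑ᶠ-δ* w (λ z → ⟦ G v z ⟧)))

  port : ∀ v w → G v w ≡ true → ∃ λ i → neighbour v i ≡ w
  port v w vw with 0<∑ᶠ⇒∃ (λ i → ⟦ neighbour v i == w ⟧)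
                     (subst (0 <_) (sym (trans (∑-neighbour-δ v w) (cong ⟦_⟧ vw))) (s≤s z≤n))
  ... | i , pos = i , ⟦==⟧>0 pos

  neighbour-injective : ∀ v {i j} → neighbour v i ≡ neighbour v j → i ≡ j
  neighbour-injective v {i} {j} eq with i ≟ j
  ... | yes i≡j = i≡j
  ... | no  i≢j = contradiction (≤-trans
        (≤-reflexive (sym (cong₂ (λ p q → ⟦ p ⟧ + ⟦ q ⟧)
           (trans (cong (_== neighbour v j) eq) (==-refl (neighbour v j))) (==-refl (neighbour v j)))))
        (≤-trans (two-terms-≤-∑ᶠ (λ k → ⟦ neighbour v k == neighbour v j ⟧) i≢j)
          (≤-trans (≤-reflexive (∑-neighbour-δ v (neighbour v j))) (⟦⟧≤1 (G v (neighbour v j))))))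
        (<⇒≱ (s≤s (s≤s z≤n)))

  -- An arc is coded by its tail and a port, the index of its head among the neighbours of the tail,
  -- so that one rotation of `Fin d` acts at all vertices at once.
  reverse : Fin n × Fin d → Fin n × Fin d
  reverse (v , i) = neighbour v i , proj₁ (port (neighbour v i) v (trans (sym-G _ _) (neighbour-edge v i)))

  reverse-target : ∀ v i → neighbour (neighbour v i) (proj₂ (reverse (v , i))) ≡ v
  reverse-target v i = proj₂ (port (neighbour v i) v (trans (sym-G _ _) (neighbour-edge v i)))

  reverse-involutive : ∀ x → reverse (reverse x) ≡ x
  reverse-involutive (v , i) = same (reverse-target v i)
    (proj₂ (port _ (neighbour v i) (trans (sym-G _ _) (neighbour-edge (neighbour v i) _))))
    where
    same : ∀ {v′ j} → v′ ≡ v → neighbour v′ j ≡ neighbour v i → (v′ , j) ≡ (v , i)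
    same refl eq = cong (v ,_) (neighbour-injective v eq)

-- Choosing rotations that pin every tail

module Pinning {n d-1} {G : Adj n} (regular : Regular (suc d-1) G)
               (codegrees : ∀ {x y} → x ≢ y → n * codegree G x y ≤ 2 * (suc d-1 * suc d-1)) where

  open RegularGraph regular
  open Rotation d-1

  private
    d = suc d-1
    nbr = neighbour regular

  -- A vertex `u` other than `v` that stays alive under all rotations could replace `v` as the image
  -- of the arc `(v , i)`; `unpinned` counts these threats.
  alive : ∀ {r} → Vec (Fin d) r → Fin n → Fin n → Fin d → Bool
  alive []       v u i = true
  alive (t ∷ ts) v u i = G u (nbr v (rotate t i)) ∧ alive ts v u i

  alive-complete : ∀ {r} (ts : Vec (Fin d) r) {v u i} →
                   (∀ k → G u (nbr v (rotate (Vec.lookup ts k) i)) ≡ true) → alive ts v u i ≡ true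
  alive-complete []       _   = refl
  alive-complete (t ∷ ts) all = cong₂ _∧_ (all zero) (alive-complete ts (all ∘ suc))

  unpinned : ∀ {r} → Vec (Fin d) r → ℕ
  unpinned ts = ∑ᶠ λ v → ∑ᶠ λ u → ∑ᶠ λ i → ⟦ not (u == v) ∧ alive ts v u i ⟧

  private
    -- For a live triple, exactly `codegree G v u` of the `d` rotations keep it alive, and this is
    -- at most 2d²/n. On average a further rotation thus keeps a proportion at most 2d/n.
    average : ∀ {r} (ts : Vec (Fin d) r) → n * ∑ᶠ (λ t → unpinned (t ∷ ts)) ≤ 2 * (d * d) * unpinned ts
    average ts = begin
      n * ∑ᶠ (λ t → unpinned (t ∷ ts))
        ≡⟨ cong (n *_) (trans (∑-comm (allFin d) (allFin n) _) (∑-cong (allFin n) λ v →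
             trans (∑-comm (allFin d) (allFin n) _) (∑-cong (allFin n) λ u → ∑-comm (allFin d) (allFin d) _))) ⟩
      n * ∑ᶠ (λ v → ∑ᶠ λ u → ∑ᶠ λ i → ∑ᶠ λ t → ⟦ not (u == v) ∧ alive (t ∷ ts) v u i ⟧)
        ≡⟨ trans (*-distribˡ-∑ (allFin n) n _) (∑-cong (allFin n) λ v →
           trans (*-distribˡ-∑ (allFin n) n _) (∑-cong (allFin n) λ u → *-distribˡ-∑ (allFin d) n _)) ⟩
      ∑ᶠ (λ v → ∑ᶠ λ u → ∑ᶠ λ i → n * ∑ᶠ λ t → ⟦ not (u == v) ∧ alive (t ∷ ts) v u i ⟧)
        ≤⟨ ∑-mono (allFin n) (λ v → ∑-mono (allFin n) λ u → ∑-mono (allFin d) λ i → bound v u i) ⟩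
      ∑ᶠ (λ v → ∑ᶠ λ u → ∑ᶠ λ i → 2 * (d * d) * ⟦ not (u == v) ∧ alive ts v u i ⟧)
        ≡⟨ sym (trans (*-distribˡ-∑ (allFin n) (2 * (d * d)) _) (∑-cong (allFin n) λ v →
           trans (*-distribˡ-∑ (allFin n) (2 * (d * d)) _) (∑-cong (allFin n) λ u → *-distribˡ-∑ (allFin d) (2 * (d * d)) _))) ⟩
      2 * (d * d) * unpinned ts ∎
      where
      open ≤-Reasoning
      zero-sum : n * ∑ᶠ {d} (λ t → 0) ≡ 0
      zero-sum = trans (cong (n *_) (trans (∑ᶠ-const {d} 0) (*-zeroʳ d))) (*-zeroʳ n)
      -- As t runs over all shifts, rotate t i runs once over all ports of v.
      ∑-codegree : ∀ v u i → ∑ᶠ (λ t → ⟦ G u (nbr v (rotate t i)) ⟧) ≡ codegree G v u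
      ∑-codegree v u i = trans (∑-rotate (λ j → ⟦ G u (nbr v j) ⟧) i) (∑-neighbour regular v (λ w → ⟦ G u w ⟧))
      bound : ∀ v u i → n * ∑ᶠ (λ t → ⟦ not (u == v) ∧ alive (t ∷ ts) v u i ⟧) ≤
                        2 * (d * d) * ⟦ not (u == v) ∧ alive ts v u i ⟧
      bound v u i with u ≟ v
      ... | yes _  = ≤-trans (≤-reflexive zero-sum) z≤n
      ... | no u≢v with alive ts v u i
      ...   | false = ≤-trans (≤-reflexive (trans (cong (n *_) (∑-cong (allFin d) λ t → ∧-false (G u (nbr v (rotate t i))))) zero-sum)) z≤n
        where
        ∧-false : ∀ b → ⟦ b ∧ false ⟧ ≡ 0
        ∧-false true  = refl
        ∧-false false = refl
      ...   | true  = begin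
        n * ∑ᶠ (λ t → ⟦ G u (nbr v (rotate t i)) ∧ true ⟧)
          ≡⟨ cong (n *_) (trans (∑-cong (allFin d) λ t → ∧-unit (G u (nbr v (rotate t i)))) (∑-codegree v u i)) ⟩
        n * codegree G v u
          ≤⟨ codegrees (u≢v ∘ sym) ⟩
        2 * (d * d)
          ≡⟨ sym (*-identityʳ _) ⟩
        2 * (d * d) * 1 ∎
        where
        ∧-unit : ∀ b → ⟦ b ∧ true ⟧ ≡ ⟦ b ⟧
        ∧-unit true  = refl
        ∧-unit false = refl

  -- The method of conditional expectations: some rotation does no worse than the average, so each
  -- choice costs a factor 2d/n, starting from at most n²d triples.
  few-unpinned : ∀ r → ∃ λ (ts : Vec (Fin d) r) → n ^ r * unpinned ts ≤ (2 * d) ^ r * (n * (n * d))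
  few-unpinned zero = [] , *-monoʳ-≤ 1 (∑-≤-const {n} _ (n * d) λ v → ∑-≤-const {n} _ d λ u →
    ≤-trans (∑-≤-const {d} (λ i → ⟦ not (u == v) ∧ true ⟧) 1 λ i → ⟦⟧≤1 (not (u == v) ∧ true)) (≤-reflexive (*-identityʳ d)))
  few-unpinned (suc r) with few-unpinned r
  ... | ts , few with ∃-below-average d-1 (λ t → unpinned (t ∷ ts))
  ... | t , t≤ = t ∷ ts , (begin
    n * n ^ r * unpinned (t ∷ ts)
      ≡⟨ e₁ n (n ^ r) (unpinned (t ∷ ts)) ⟩
    n ^ r * (n * unpinned (t ∷ ts))
      ≤⟨ *-monoʳ-≤ (n ^ r) (*-cancelˡ-≤ d (begin
           d * (n * unpinned (t ∷ ts))            ≡⟨ e₂ d n _ ⟩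
           n * (d * unpinned (t ∷ ts))            ≤⟨ *-monoʳ-≤ n t≤ ⟩
           n * ∑ᶠ (λ t → unpinned (t ∷ ts))       ≤⟨ average ts ⟩
           2 * (d * d) * unpinned ts              ≡⟨ e₃ d (unpinned ts) ⟩
           d * (2 * d * unpinned ts)              ∎)) ⟩
    n ^ r * (2 * d * unpinned ts)
      ≡⟨ e₂ (n ^ r) (2 * d) _ ⟩
    2 * d * (n ^ r * unpinned ts)
      ≤⟨ *-monoʳ-≤ (2 * d) few ⟩
    2 * d * ((2 * d) ^ r * (n * (n * d)))
      ≡⟨ sym (*-assoc (2 * d) ((2 * d) ^ r) (n * (n * d))) ⟩
    2 * d * (2 * d) ^ r * (n * (n * d)) ∎)
    where
    open ≤-Reasoning
    e₁ : ∀ a b c → a * b * c ≡ b * (a * c)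
    e₁ = solve-∀
    e₂ : ∀ a b c → a * (b * c) ≡ b * (a * c)
    e₂ = solve-∀
    e₃ : ∀ d x → 2 * (d * d) * x ≡ d * (2 * d * x)
    e₃ = solve-∀

  -- By `small` fewer than one triple survives, hence none. The Boolean in `Arc` is the side that
  -- makes the graph bipartite.
  ¬mobile-regular : ∀ r → 0 < n → (2 * d) ^ r * (n * (n * d)) < n ^ r → ∀ k → r * 2 + 2 ≤ k → ¬ Mobile k G
  ¬mobile-regular r n>0 small = FrozenHom.¬mobile simple φ side (λ k → encode ∘ step k ∘ decode) (λ k → encode ∘ back k ∘ decode)
      (λ k x → trans (cong (encode ∘ back k) (decode-encode (step k (decode x))))
                     (trans (cong encode (back-step k (decode x))) (encode-decode x)))
      (λ k x → cong (λ y → proj₂ y) (decode-encode (step k (decode x))))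
      (λ k x → trans (cong (G (φ x)) (φ-step k x)) (neighbour-edge regular _ _))
      (λ x u all → pinned x u λ k → trans (cong (G u) (sym (φ-step k x))) (all k))
      (neighbour-edge regular a zero)
      -- An arc on the side that the two-valued map sends to `a`. Its tail is a neighbour of `a`,
      -- hence not `a`, so the two homomorphisms differ here.
      (encode ((nbr a zero , zero) , true))
      (cong proj₂ (decode-encode ((nbr a zero , zero) , true)))
      λ eq → distinct (trans (sym (cong (proj₁ ∘ proj₁) (decode-encode ((nbr a zero , zero) , true)))) eq)
    where
    Arc = (Fin n × Fin d) × Bool

    a : Fin n
    a = fromℕ< n>0

    distinct : nbr a zero ≢ a
    distinct eq with trans (sym (neighbour-edge regular a zero)) (trans (cong (G a) eq) (irr-G a))
    ... | ()

    bit : Bool → Fin 2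
    bit true  = zero
    bit false = suc zero

    unbit : Fin 2 → Bool
    unbit zero       = true
    unbit (suc zero) = false

    unbit-bit : ∀ b → unbit (bit b) ≡ b
    unbit-bit true  = refl
    unbit-bit false = refl

    bit-unbit : ∀ i → bit (unbit i) ≡ i
    bit-unbit zero       = refl
    bit-unbit (suc zero) = refl

    encode : Arc → Fin (n * d * 2)
    encode ((v , i) , s) = combine (combine v i) (bit s)

    decode : Fin (n * d * 2) → Arc
    decode x = remQuot d (proj₁ (remQuot {n * d} 2 x)) , unbit (proj₂ (remQuot {n * d} 2 x))

    decode-encode : ∀ y → decode (encode y) ≡ y
    decode-encode ((v , i) , s) = trans
      (cong (λ p → remQuot d (proj₁ p) , unbit (proj₂ p)) (remQuot-combine (combine v i) (bit s)))
      (cong₂ _,_ (remQuot-combine v i) (unbit-bit s))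

    encode-decode : ∀ x → encode (decode x) ≡ x
    encode-decode x = trans
      (cong₂ combine (combine-remQuot {n} d (proj₁ (remQuot {n * d} 2 x))) (bit-unbit (proj₂ (remQuot {n * d} 2 x))))
      (combine-remQuot {n * d} 2 x)

    φ : Fin (n * d * 2) → Fin n
    φ x = proj₁ (proj₁ (decode x))

    side : Fin (n * d * 2) → Bool
    side x = proj₂ (decode x)

    ts : Vec (Fin d) r
    ts = proj₁ (few-unpinned r)

    shift : Fin r → Fin d
    shift = Vec.lookup ts

    step back : Fin r → Arc → Arc
    step k ((v , i) , s) = reverse regular (v , rotate (shift k) i) , not s
    back k (x , s) = (proj₁ (reverse regular x) , unrotate (shift k) (proj₂ (reverse regular x))) , not s

    back-step : ∀ k y → back k (step k y) ≡ y
    back-step k ((v , i) , s) = cong₂ _,_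
      (trans (cong (λ x → proj₁ x , unrotate (shift k) (proj₂ x)) (reverse-involutive regular (v , rotate (shift k) i)))
             (cong (v ,_) (unrotate-rotate (shift k) i)))
      (not-involutive s)

    φ-step : ∀ k x → φ (encode (step k (decode x))) ≡ nbr (φ x) (rotate (shift k) (proj₂ (proj₁ (decode x))))
    φ-step k x = cong (proj₁ ∘ proj₁) (decode-encode (step k (decode x)))

    all-pinned : unpinned ts ≡ 0
    all-pinned with unpinned ts | proj₂ (few-unpinned r)
    ... | zero  | _   = refl
    ... | suc l | few = contradiction (≤-trans (m≤m*n (n ^ r) (suc l)) few) (<⇒≱ small)

    pinned : ∀ x u → (∀ k → G u (nbr (φ x) (rotate (shift k) (proj₂ (proj₁ (decode x))))) ≡ true) → u ≡ φ x
    pinned x u all = by-cases (u ≟ φ x)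
      where
      i = proj₂ (proj₁ (decode x))
      by-cases : Dec (u ≡ φ x) → u ≡ φ x
      by-cases (yes u≡) = u≡
      by-cases (no u≢)  = contradiction
        (trans (sym (∑ᶠ≡0⇒≡0 (λ i → ⟦ not (u == φ x) ∧ alive ts (φ x) u i ⟧)
                 (∑ᶠ≡0⇒≡0 (λ u → ∑ᶠ λ i → ⟦ not (u == φ x) ∧ alive ts (φ x) u i ⟧)
                   (∑ᶠ≡0⇒≡0 (λ v → ∑ᶠ λ u → ∑ᶠ λ i → ⟦ not (u == v) ∧ alive ts v u i ⟧) all-pinned (φ x)) u) i))
               (cong ⟦_⟧ (cong₂ _∧_ (cong not (≢⇒==-false u≢)) (alive-complete ts all))))
        λ ()

-- If 2r colours do not suffice, then `k > c` means k ≥ 2r + 2, just enough for a graph of degree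
-- 2r. M is twice the number of colours to be excluded, and its codegree bound implies the cruder
-- factor 2 used for pinning.
mobility≤chromatic : ∀ {n d r} {G : Adj n} → Regular d G → 0 < n → 0 < r →
  (let M = 2 * (r * 2)) →
  2 * (r * 2 * (r * 2)) < d →
  (2 * d) ^ r * (n * (n * d)) < n ^ r →
  (∀ {x y} → x ≢ y → M * (n * codegree G x y) ≤ suc M * (d * d)) → MobilityLeChromatic G
mobility≤chromatic {n} {d@(suc _)} {r} {G} regular n>0 r>0 r≪d small codegrees c (colorable , _) k mobile =
  ≮⇒≥ λ c<k → Pinning.¬mobile-regular regular codegrees′ r n>0 small k
    (≤-trans (≤-reflexive (+-comm (r * 2) 2)) (≤-trans (s≤s 2r<c) c<k)) mobile
  where
  2r<c : r * 2 < c
  2r<c = ≰⇒> λ c≤2r → ¬colorable regular (r * 2) n>0 r≪d codegrees (Colorable-mono {G = G} c≤2r colorable)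
  M = 2 * (r * 2)
  M>0 : 0 < M
  M>0 = *-mono-≤ {1} {2} (s≤s z≤n) (*-mono-≤ {1} {r} {1} {2} r>0 (s≤s z≤n))
  codegrees′ : ∀ {x y} → x ≢ y → n * codegree G x y ≤ 2 * (d * d)
  codegrees′ {x} {y} x≢y = *-cancelˡ-≤ M {{>-nonZero M>0}} (begin
    M * (n * codegree G x y)  ≤⟨ codegrees x≢y ⟩
    suc M * (d * d)           ≤⟨ *-monoˡ-≤ (d * d) (+-monoˡ-≤ M M>0) ⟩
    (M + M) * (d * d)         ≡⟨ e₁ M (d * d) ⟩
    M * (2 * (d * d))         ∎)
    where
    open ≤-Reasoning
    e₁ : ∀ M D → (M + M) * D ≡ M * (2 * D)
    e₁ = solve-∀

-- Asymptotics

^-distribʳ-* : ∀ a b k → (a * b) ^ k ≡ a ^ k * b ^ k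
^-distribʳ-* a b zero    = refl
^-distribʳ-* a b (suc k) = trans (cong (a * b *_) (^-distribʳ-* a b k)) (interchange a b (a ^ k) (b ^ k))
  where
  interchange : ∀ a b c d → a * b * (c * d) ≡ a * c * (b * d)
  interchange = solve-∀

n<2^n : ∀ n → n < 2 ^ n
n<2^n zero    = s≤s z≤n
n<2^n (suc n) = ≤-trans (+-mono-≤ (≤-trans (s≤s z≤n) (n<2^n n)) (n<2^n n))
                        (≤-reflexive (cong (2 ^ n +_) (sym (+-identityʳ (2 ^ n)))))

-- Bernoulli's inequality (1 + 1/a)^m ≥ 1 + m/a, multiplied by a^(m+1).
bernoulli : ∀ a m → a ^ m * (a + m) ≤ a * (a + 1) ^ m
bernoulli a zero    = ≤-reflexive (e a)
  where
  e : ∀ a → 1 * (a + 0) ≡ a * 1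
  e = solve-∀
bernoulli a (suc m) = begin
  a * a ^ m * (a + suc m)                     ≤⟨ m≤m+n _ (a ^ m * m) ⟩
  a * a ^ m * (a + suc m) + a ^ m * m         ≡⟨ e₁ a m (a ^ m) ⟩
  (a + 1) * (a ^ m * (a + m))                 ≤⟨ *-monoʳ-≤ (a + 1) (bernoulli a m) ⟩
  (a + 1) * (a * (a + 1) ^ m)                 ≡⟨ e₂ a ((a + 1) ^ m) ⟩
  a * ((a + 1) * (a + 1) ^ m)                 ∎
  where
  open ≤-Reasoning
  e₁ : ∀ a m z → a * z * (a + suc m) + z * m ≡ (a + 1) * (z * (a + m))
  e₁ = solve-∀
  e₂ : ∀ a z → (a + 1) * (a * z) ≡ a * ((a + 1) * z)
  e₂ = solve-∀

2*a^a≤[a+1]^a : ∀ a → 0 < a → 2 * a ^ a ≤ (a + 1) ^ a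
2*a^a≤[a+1]^a a a>0 = *-cancelˡ-≤ a {{>-nonZero a>0}} (≤-trans (≤-reflexive (e a (a ^ a))) (bernoulli a a))
  where
  e : ∀ a z → a * (2 * z) ≡ z * (a + a)
  e = solve-∀

2^y*a^ay≤[a+1]^ay : ∀ a y → 0 < a → 2 ^ y * a ^ (a * y) ≤ (a + 1) ^ (a * y)
2^y*a^ay≤[a+1]^ay a y a>0 = subst₂ _≤_
  (trans (^-distribʳ-* 2 (a ^ a) y) (cong (2 ^ y *_) (^-*-assoc a a y)))
  (^-*-assoc (a + 1) a y)
  (^-monoˡ-≤ y (2*a^a≤[a+1]^a a a>0))

m<n*[1+m/n] : ∀ m n .{{_ : NonZero n}} → m < n * suc (m / n)
m<n*[1+m/n] m n = begin-strict
  m                        ≡⟨ m≡m%n+[m/n]*n m n ⟩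
  m % n + m / n * n ≡⟨ +-comm (m % n) _ ⟩
  m / n * n + m % n <⟨ +-monoʳ-< (m / n * n) (m%n<n m n) ⟩
  m / n * n + n            ≡⟨ +-comm _ n ⟩
  n + m / n * n            ≡⟨ *-comm (suc (m / n)) n ⟩
  n * suc (m / n)          ∎
  where open ≤-Reasoning

-- With w = e + 1 and z the integer part of y/w, `suc y` is at most w 2^z. Of the w factors 2^z
-- inside 2^y, e pay for the power and the last pays for the constant A w^e; `Y` is chosen so that
-- this constant is at most z.
polynomial≤exponential : ∀ e A → ∃ λ Y → ∀ y → Y ≤ y → A * suc y ^ e ≤ 2 ^ y
polynomial≤exponential e A = A * w ^ e * w , λ y Y≤y →
  let z = y / w
      open ≤-Reasoning
      suc-y≤ : suc y ≤ w * 2 ^ z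
      suc-y≤ = ≤-trans (m<n*[1+m/n] y w) (*-monoʳ-≤ w (n<2^n z))
      large : A * w ^ e ≤ z
      large = subst (_≤ z) (m*n/n≡m (A * w ^ e) w) (/-monoˡ-≤ w Y≤y)
  in begin
    A * suc y ^ e               ≤⟨ *-monoʳ-≤ A (^-monoˡ-≤ e suc-y≤) ⟩
    A * (w * 2 ^ z) ^ e         ≡⟨ trans (cong (A *_) (^-distribʳ-* w (2 ^ z) e)) (sym (*-assoc A (w ^ e) _)) ⟩
    A * w ^ e * (2 ^ z) ^ e     ≤⟨ *-monoˡ-≤ _ (≤-trans large (<⇒≤ (n<2^n z))) ⟩
    (2 ^ z) ^ w                 ≡⟨ ^-*-assoc 2 z w ⟩
    2 ^ (z * w)                 ≤⟨ ^-monoʳ-≤ 2 (m/n*n≤m y w) ⟩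
    2 ^ y                       ∎
  where
  w = suc e

-- The bounds n^(1/2 + p/q) < d < n^(1 - p/q), raised to the powers 2q and q to make all exponents
-- natural numbers.
module Growth (p q : ℕ) (p>0 : 0 < p) (4p<q : 4 * p < q) {n d : ℕ} (n>0 : 0 < n)
              (lower : n ^ (q + 2 * p) < d ^ (2 * q)) (upper : d ^ q < n ^ (q ∸ p)) where

  private
    instance
      n-nonZero : NonZero n
      n-nonZero = >-nonZero n>0

    p≤q : p ≤ q
    p≤q = ≤-trans (m≤m+n p (3 * p)) (<⇒≤ 4p<q)

    q>0 : 0 < q
    q>0 = ≤-trans p>0 p≤q

    n≤n^ : ∀ {e} → 0 < e → n ≤ n ^ e
    n≤n^ {e} e>0 = subst (_≤ n ^ e) (^-identityʳ n) (^-monoʳ-≤ n e>0)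

  -- `upper` leaves a factor n^p to spare, which absorbs C^q as soon as n ≥ C^q.
  *d≤n : ∀ C → C ^ q ≤ n → C * d ≤ n
  *d≤n zero      _     = z≤n
  *d≤n C@(suc _) C^q≤n = ≮⇒≥ λ n<Cd → n≮n (n ^ q) (begin-strict
    n ^ q                  ≤⟨ ^-monoˡ-≤ q (<⇒≤ n<Cd) ⟩
    (C * d) ^ q            ≡⟨ ^-distribʳ-* C d q ⟩
    C ^ q * d ^ q          <⟨ *-monoʳ-< (C ^ q) {{m^n≢0 C q}} upper ⟩
    C ^ q * n ^ (q ∸ p)    ≤⟨ *-monoˡ-≤ _ (≤-trans C^q≤n (n≤n^ p>0)) ⟩
    n ^ p * n ^ (q ∸ p)    ≡⟨ trans (sym (^-distribˡ-+-* n p (q ∸ p))) (cong (n ^_) (m+[n∸m]≡n p≤q)) ⟩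
    n ^ q                  ∎)
    where open ≤-Reasoning

  <d : ∀ X → X ^ (2 * q) ≤ n → X < d
  <d X X^2q≤n = ≰⇒> λ d≤X → <⇒≱ lower (≤-trans (^-monoˡ-≤ (2 * q) d≤X)
    (≤-trans X^2q≤n (n≤n^ (≤-trans q>0 (m≤m+n q (2 * p))))))

  d≤n : d ≤ n
  d≤n = subst (_≤ n) (*-identityˡ d) (*d≤n 1 (subst (_≤ n) (sym (^-zeroˡ q)) n>0))

  -- The fourth power of `upper` saves n^(4p) ≥ n⁴: one factor n pays for 2^(4q) and three for n · n
  -- · d.
  pinning-condition : 2 ^ (q * 4) ≤ n → (2 * d) ^ (q * 4) * (n * (n * d)) < n ^ (q * 4)
  pinning-condition 2^4q≤n = begin-strict
    (2 * d) ^ (q * 4) * (n * (n * d))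
      ≡⟨ cong (_* (n * (n * d))) (trans (^-distribʳ-* 2 d (q * 4)) (cong (2 ^ (q * 4) *_) (sym (^-*-assoc d q 4)))) ⟩
    2 ^ (q * 4) * (d ^ q) ^ 4 * (n * (n * d))
      ≤⟨ *-mono-≤ (*-monoˡ-≤ ((d ^ q) ^ 4) 2^4q≤n) (*-monoʳ-≤ n (*-monoʳ-≤ n d≤n)) ⟩
    n * (d ^ q) ^ 4 * (n * (n * n))
      ≡⟨ e₁ n ((d ^ q) ^ 4) ⟩
    n ^ 4 * (d ^ q) ^ 4
      <⟨ *-monoʳ-< (n ^ 4) {{m^n≢0 n 4}} (^-monoˡ-< 4 upper) ⟩
    n ^ 4 * (n ^ (q ∸ p)) ^ 4
      ≤⟨ *-monoˡ-≤ _ (^-monoˡ-≤ 4 (n≤n^ p>0)) ⟩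
    (n ^ p) ^ 4 * (n ^ (q ∸ p)) ^ 4
      ≡⟨ sym (^-distribʳ-* (n ^ p) (n ^ (q ∸ p)) 4) ⟩
    (n ^ p * n ^ (q ∸ p)) ^ 4
      ≡⟨ cong (_^ 4) (trans (sym (^-distribˡ-+-* n p (q ∸ p))) (cong (n ^_) (m+[n∸m]≡n p≤q))) ⟩
    (n ^ q) ^ 4
      ≡⟨ ^-*-assoc n q 4 ⟩
    n ^ (q * 4) ∎
    where
    open ≤-Reasoning
    e₁ : ∀ n z → n * z * (n * (n * n)) ≡ n * (n * (n * (n * 1))) * z
    e₁ = solve-∀

  -- Applied with E n s slightly above d²: it says that d²/n exceeds a power of n.
  n<[Es]^q : ∀ E s → d * d < E * n * s → n < (E * s) ^ q
  n<[Es]^q E s d²< = *-cancelʳ-< (n ^ q) n ((E * s) ^ q) (begin-strict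
    n * n ^ q                ≤⟨ *-monoˡ-≤ (n ^ q) (n≤n^ (≤-trans p>0 (m≤m+n p (p + 0)))) ⟩
    n ^ (2 * p) * n ^ q      ≡⟨ trans (sym (^-distribˡ-+-* n (2 * p) q)) (cong (n ^_) (+-comm (2 * p) q)) ⟩
    n ^ (q + 2 * p)          <⟨ lower ⟩
    d ^ (2 * q)              ≡⟨ trans (sym (^-*-assoc d 2 q)) (cong (λ z → (d * z) ^ q) (*-identityʳ d)) ⟩
    (d * d) ^ q              ≤⟨ ^-monoˡ-≤ q (<⇒≤ d²<) ⟩
    (E * n * s) ^ q          ≡⟨ trans (cong (_^ q) (e₁ E n s)) (^-distribʳ-* (E * s) n q) ⟩
    (E * s) ^ q * n ^ q      ∎)
    where
    open ≤-Reasoning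
    e₁ : ∀ E n s → E * n * s ≡ E * s * n
    e₁ = solve-∀

  -- Since (1 + 1/4M)^(4M) ≥ 2, the decay over t = 4My steps is at most 2^(-y). As n < (E(y + 1))^q,
  -- the cubic factor of the union bound is at most a polynomial in y of degree 3q, which 2^y
  -- outgrows.
  tail-condition : ∀ M k Y → 0 < M → (let E = 8 * (M * M)) →
    (∀ y → Y ≤ y → suc k * 2 * (E ^ q) ^ 3 * suc y ^ (q * 3) ≤ 2 ^ y) → (E * Y) ^ q ≤ n →
    ∃ λ t → 2 * M * (n * t) ≤ d * d × suc k * (n * (n * (suc n * (4 * M) ^ t))) ≤ (4 * M + 1) ^ t
  tail-condition M k Y M>0 exponential EY^q≤n = 4 * M * y , t-small , (begin
      suc k * (n * (n * (suc n * (4 * M) ^ t)))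
        ≤⟨ *-monoʳ-≤ (suc k) (*-monoʳ-≤ n (*-monoʳ-≤ n (*-monoˡ-≤ _ (+-monoˡ-≤ n n>0)))) ⟩
      suc k * (n * (n * ((n + n) * (4 * M) ^ t)))
        ≡⟨ e₁ k n ((4 * M) ^ t) ⟩
      suc k * 2 * n ^ 3 * (4 * M) ^ t
        ≤⟨ *-monoˡ-≤ _ (≤-trans (*-monoʳ-≤ (suc k * 2) (^-monoˡ-≤ 3 (<⇒≤ n<))) (≤-reflexive power)) ⟩
      suc k * 2 * (E ^ q) ^ 3 * suc y ^ (q * 3) * (4 * M) ^ t
        ≤⟨ *-monoˡ-≤ _ (exponential y Y≤y) ⟩
      2 ^ y * (4 * M) ^ t
        ≤⟨ 2^y*a^ay≤[a+1]^ay (4 * M) y (*-mono-≤ {1} {4} {1} {M} (s≤s z≤n) M>0) ⟩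
      (4 * M + 1) ^ t ∎)
    where
    open ≤-Reasoning
    -- With t = 4My the product 2M · n · t equals y · E · n, which fixes both `E` and the quotient
    -- `y`.
    E = 8 * (M * M)
    E>0 : 0 < E
    E>0 = *-mono-≤ {1} {8} {1} {M * M} (s≤s z≤n) (*-mono-≤ M>0 M>0)
    instance
      En-nonZero : NonZero (E * n)
      En-nonZero = >-nonZero (*-mono-≤ E>0 n>0)
    y = d * d / (E * n)
    t = 4 * M * y
    n< : n < (E * suc y) ^ q
    n< = n<[Es]^q E (suc y) (m<n*[1+m/n] (d * d) (E * n))
    Y≤y : Y ≤ y
    Y≤y = ≮⇒≥ λ y<Y → <⇒≱ n< (≤-trans (^-monoˡ-≤ q (*-monoʳ-≤ E y<Y)) EY^q≤n)
    e₁ : ∀ k n z → suc k * (n * (n * ((n + n) * z))) ≡ suc k * 2 * (n * (n * (n * 1))) * z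
    e₁ = solve-∀
    e₂ : ∀ M n y → 2 * M * (n * (4 * M * y)) ≡ y * (8 * (M * M) * n)
    e₂ = solve-∀
    t-small : 2 * M * (n * t) ≤ d * d
    t-small = ≤-trans (≤-reflexive (e₂ M n y)) (m/n*n≤m (d * d) (E * n))
    power : suc k * 2 * ((E * suc y) ^ q) ^ 3 ≡ suc k * 2 * (E ^ q) ^ 3 * suc y ^ (q * 3)
    power = trans (cong (suc k * 2 *_) (trans (cong (_^ 3) (^-distribʳ-* E (suc y) q))
              (trans (^-distribʳ-* (E ^ q) (suc y ^ q) 3) (cong ((E ^ q) ^ 3 *_) (^-*-assoc (suc y) q 3)))))
              (sym (*-assoc (suc k * 2) ((E ^ q) ^ 3) (suc y ^ (q * 3))))

-- A real α may be lowered to a rational p/q, which weakens both bounds on d. Probability tending to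
-- 1 becomes a proportion of at least k/(k + 1) for each `k` from some `n` on, with `Every` a list
-- of all d-regular graphs without repetition.
theorem6p4 : (p q : ℕ) → 0 < p → 4 * p < q →
    (d : ℕ → ℕ) →
    Σ ℕ (λ N₀ → ∀ n → N₀ ≤ n → (n ^ (q + 2 * p) < d n ^ (2 * q)) × (d n ^ q < n ^ (q ∸ p))) →
    ∀ (k : ℕ) → Σ ℕ λ N → ∀ n → N ≤ n →
    Σ (List (Adj n)) λ Good →
    AllPairs Differ Good × All (λ G → Regular (d n) G × MobilityLeChromatic G) Good ×
    (∀ (Every : List (Adj n)) → AllPairs Differ Every → All (Regular (d n)) Every →
    k * length Every ≤ suc k * length Good)
theorem6p4 p q p>0 4p<q d (N₀ , growth) k = N , λ n N≤n →
  let N₀≤n , rest₁ = split N₀ N≤n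
      n>0 , rest₂ = split 1 rest₁
      sparse , rest₃ = split ((6 * (4 * M + 2)) ^ q) rest₂
      dense , rest₄ = split ((2 * (r * 2 * (r * 2))) ^ (2 * q)) rest₃
      pin , tail = split (2 ^ r) rest₄
      lower , upper = growth n N₀≤n
      open Growth p q p>0 4p<q n>0 lower upper
      r≪d = <d (2 * (r * 2 * (r * 2))) dense
      t , t-small , t-large = tail-condition M k Y M>0 exponential tail
      open CodegreeTail M n (d n) (≤-trans (s≤s z≤n) r≪d) (*d≤n (6 * (4 * M + 2)) sparse)
  in filterᵇ isTypical (graphs n) ,
     AllPairs.filter⁺ (T? ∘ isTypical) (graphs-apart n) ,
     All.map (λ {G} typical →
         let regular = isRegular-sound {G = G} (proj₁ (∧-true {isRegular (d n) G} typical))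
         in regular , mobility≤chromatic {r = r} regular n>0 r>0 r≪d (pinning-condition pin) (typical-codegree {G} typical))
       (all-filterᵇ isTypical (graphs n)) ,
     λ Every apart regular → ≤-trans (*-monoʳ-≤ k (every-≤-regular Every apart regular))
       (≤-trans (typical-proportion k t t-small t-large)
         (≤-reflexive (cong (suc k *_) (sym (length-filterᵇ isTypical (graphs n))))))
  where
  r = q * 4
  M = 2 * (r * 2)
  r>0 : 0 < r
  r>0 = *-mono-≤ {1} {q} {1} {4} (≤-trans (s≤s z≤n) 4p<q) (s≤s z≤n)
  M>0 : 0 < M
  M>0 = *-mono-≤ {1} {2} (s≤s z≤n) (*-mono-≤ {1} {r} {1} {2} r>0 (s≤s z≤n))
  E = 8 * (M * M)
  Y = proj₁ (polynomial≤exponential (q * 3) (suc k * 2 * (E ^ q) ^ 3))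
  exponential = proj₂ (polynomial≤exponential (q * 3) (suc k * 2 * (E ^ q) ^ 3))
  -- A sum dominates each of its thresholds, and `split` peels them off in turn: the growth of d, n
  -- > 0, d small against n for the switchings, d large for the colouring, the pinning and the tail.
  N = N₀ + (1 + ((6 * (4 * M + 2)) ^ q + ((2 * (r * 2 * (r * 2))) ^ (2 * q) + (2 ^ r + (E * Y) ^ q))))
  split : ∀ a {b n} → a + b ≤ n → a ≤ n × b ≤ n
  split a {b} a+b≤n = ≤-trans (m≤m+n a b) a+b≤n , ≤-trans (m≤n+m b a) a+b≤n
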